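{- Let $G$ be a graph with edge set $E$, let $k\ge1$, and suppose $M_k(G)$ is a non-trivial matroid (so that $G$ has a component with at least two cycles and the core $[G]$ is defined). Let $t(H)$ be the number of tree components of a graph $H$ and $Y(G)=\{e\in E: t(G\setminus e)>t(G)\}$. Then the set of coloops of $M_k(G)$ equals $E\setminus E([G])$, and this set equals $Y(G)$.
   Context: Graphs are finite, may have loops and parallel edges, and have no isolated vertices; $G\setminus e$ deletes the edge $e$ and keeps all vertices (a single vertex counts as a tree component). A leaf is a vertex incident to exactly one edge, which is not a loop. $\Delta H=|E(H)|-|V(H)|$. For $X\subseteq E$, $G\langle X\rangle$ is the subgraph with edge set $X$ and vertex set the vertices incident to $X$. For $k\ge0$, $M_k(G)$ is the matroid on $E$ whose circuits are the inclusion-minimal members of $\{C\subseteq E:C\neq\emptyset,\ |C|=|V(G\langle C\rangle)|+k\}$. A matroid is non-trivial if it has at least one circuit and at least one cocircuit. A coloop is an element lying in no circuit. For a connected graph $A$ containing a cycle, its kernel $\lfloor A\rfloor$ is the subgraph obtained by repeatedly deleting leaves (with incident edges) until none remain; the core $[G]$ is the union of $\lfloor A\rfloor$ over components $A$ of $G$ with $\Delta A\ge1$. -}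

module Defs where

open import Level using (0ℓ)
open import Data.Empty using (⊥-elim)
open import Data.Fin using (Fin; zero; suc) renaming (_≟_ to _≟ᶠ_)
open import Data.Fin.Properties using (any?; all?)
open import Data.Fin.Subset
open import Data.Fin.Subset.Properties
import Data.Integer as ℤ
open ℤ using (ℤ; _⊖_; 1ℤ)
open import Data.Bool using () renaming (_≟_ to _≟ᵇ_)
open import Data.List using (List; []; _∷_; map; filter; foldr; length; allFin; deduplicate)
open import Data.List.Membership.Propositional using (find; lose)
open import Data.List.Membership.Propositional.Properties using (∈-allFin; ∈-filter⁺; ∈-filter⁻)
open import Data.List.Relation.Unary.Any using (Any; here; there)
open import Data.Nat using (ℕ; zero; suc; _+_; _≤_; _<_; _>_; z≤n; s≤s; s≤s⁻¹)
import Data.Nat as ℕ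
open import Data.Nat.GeneralisedArithmetic using (iterate)
open import Data.Nat.Induction using (<-wellFounded)
open import Data.Nat.Properties
  using (≤-trans; ≤-reflexive; +-suc; +-mono-≤; +-monoˡ-≤; +-monoʳ-≤; +-cancelʳ-≤; m≤m+n; ≰⇒>;
         m≤n⇒m<n∨m≡n; module ≤-Reasoning)
open import Data.Nat.Tactic.RingSolver using (solve-∀)
open import Data.Product using (_×_; _,_; ∃; ∃-syntax; proj₁; proj₂)
open import Data.Product.Properties using () renaming (≡-dec to ×-≡-dec)
open import Data.Sum using (_⊎_; inj₁; inj₂; [_,_]′)
open import Data.Vec using (tabulate; []; _∷_)
open import Data.Vec.Properties using (lookup⇒[]=; []=⇒lookup; lookup∘tabulate) renaming (≡-dec to Vec-≡-dec)
open import Function using (_∘_)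
open import Induction.WellFounded using (Acc; acc)
open import Relation.Binary.Construct.Closure.ReflexiveTransitive using (Star; ε; _◅_; _◅◅_; gmap)
open import Relation.Binary.PropositionalEquality using (_≡_; _≢_; refl; sym; trans; cong; cong₂; subst)
open import Relation.Nullary using (¬_; Dec; yes; no; does)
open import Relation.Nullary.Decidable using (_×-dec_; _⊎-dec_; _→-dec_; ¬?; map′; dec-true)
open import Relation.Unary using (Pred; Decidable)

private variable
  n m : ℕ

select : {P : Pred (Fin n) 0ℓ} → Decidable P → Subset n
select P? = tabulate (does ∘ P?)

module _ {P : Pred (Fin n) 0ℓ} (P? : Decidable P) where

  ∈-select⁺ : ∀ {x} → P x → x ∈ select P?
  ∈-select⁺ {x} px =
    lookup⇒[]= x _ (trans (lookup∘tabulate (does ∘ P?) x) (dec-true (P? x) px))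

  ∈-select⁻ : ∀ {x} → x ∈ select P? → P x
  ∈-select⁻ {x} x∈ with P? x | trans (sym (lookup∘tabulate (does ∘ P?) x)) ([]=⇒lookup x∈)
  ... | yes px | _ = px

Minimal : Pred (Subset n) 0ℓ → Pred (Subset n) 0ℓ
Minimal P X = P X × (∀ {Y} → P Y → Y ⊆ X → X ⊆ Y)

Maximal : Pred (Subset n) 0ℓ → Pred (Subset n) 0ℓ
Maximal P X = P X × (∀ {Y} → P Y → X ⊆ Y → Y ⊆ X)

record Matroid (m : ℕ) : Set₁ where
  field
    Circuit              : Pred (Subset m) 0ℓ
    circuit-nonempty     : ∀ {C} → Circuit C → Nonempty C
    circuit-incomparable : ∀ {C D} → Circuit C → Circuit D → C ⊆ D → C ≡ D
    circuit-elimination  : ∀ {C D e} → Circuit C → Circuit D → C ≢ D → e ∈ C → e ∈ D →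
                           ∃[ F ] (Circuit F × F ⊆ (C ∪ D) - e)

module _ (M : Matroid m) where
  open Matroid M

  Independent : Pred (Subset m) 0ℓ
  Independent I = ∀ {C} → Circuit C → C ⊈ I

  Basis : Pred (Subset m) 0ℓ
  Basis = Maximal Independent

  -- independent in the dual matroid, whose bases are the complements of the bases of M
  Coindependent : Pred (Subset m) 0ℓ
  Coindependent I = ∃[ B ] (Basis B × I ⊆ ∁ B)

  Cocircuit : Pred (Subset m) 0ℓ
  Cocircuit = Minimal (λ C → ¬ Coindependent C)

  NonTrivial : Set
  NonTrivial = ∃ Circuit × ∃ Cocircuit

  Coloop : Pred (Fin m) 0ℓ
  Coloop e = ∀ {C} → Circuit C → e ∉ C

-- The order of the two ends of an edge carries no meaning; an edge whose ends
-- coincide is a loop.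
record Graph (n m : ℕ) : Set where
  field
    ends : Fin m → Fin n × Fin n

  source target : Fin m → Fin n
  source e = proj₁ (ends e)
  target e = proj₂ (ends e)

  Incident : Fin m → Fin n → Set
  Incident e v = v ≡ source e ⊎ v ≡ target e

  Joins : Fin m → Fin n → Fin n → Set
  Joins e u v = ends e ≡ (u , v) ⊎ ends e ≡ (v , u)

  Loop : Fin m → Set
  Loop e = source e ≡ target e

  incident? : ∀ e v → Dec (Incident e v)
  incident? e v = (v ≟ᶠ source e) ⊎-dec (v ≟ᶠ target e)

  joins? : ∀ e u v → Dec (Joins e u v)
  joins? e u v = ×-≡-dec _≟ᶠ_ _≟ᶠ_ (ends e) (u , v) ⊎-dec ×-≡-dec _≟ᶠ_ _≟ᶠ_ (ends e) (v , u)

  NoIsolatedVertices : Set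
  NoIsolatedVertices = ∀ v → ∃[ e ] Incident e v

-- Subgraphs may have isolated vertices.
record Subgraph (G : Graph n m) : Set where
  open Graph G
  field
    verts  : Subset n
    edges  : Subset m
    closed : ∀ {e v} → e ∈ edges → Incident e v → v ∈ verts

open Subgraph public

private variable
  G : Graph n m

whole : (G : Graph n m) → Subgraph G
whole G = record { verts = ⊤ ; edges = ⊤ ; closed = λ _ _ → ∈⊤ }

_∖ₑ_ : {G : Graph n m} → Subgraph G → Fin m → Subgraph G
H ∖ₑ e = record
  { verts  = verts H
  ; edges  = edges H - e
  ; closed = λ f∈ → closed H (p─q⊆p (edges H) ⁅ e ⁆ f∈)
  }

_∖ᵥ_ : {G : Graph n m} → Subgraph G → Fin n → Subgraph G
_∖ᵥ_ {G = G} H v = record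
  { verts  = verts H - v
  ; edges  = select keep?
  ; closed = λ e∈ i → let (e∈H , ¬i) = ∈-select⁻ keep? e∈
                      in x∈p∧x≢y⇒x∈p-y (closed H e∈H i) λ { refl → ¬i i }
  }
  where
  open Graph G
  keep? : Decidable (λ e → e ∈ edges H × ¬ Incident e v)
  keep? e = (e ∈? edges H) ×-dec ¬? (incident? e v)

∅ᴳ : Subgraph G
∅ᴳ = record { verts = ⊥ ; edges = ⊥ ; closed = λ e∈ _ → ⊥-elim (∉⊥ e∈) }

_∪ᴳ_ : Subgraph G → Subgraph G → Subgraph G
H ∪ᴳ K = record
  { verts  = verts H ∪ verts K
  ; edges  = edges H ∪ edges K
  ; closed = λ e∈ i → x∈p∪q⁺ ([ (λ h → inj₁ (closed H h i)) , (λ h → inj₂ (closed K h i)) ]′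
                               (x∈p∪q⁻ (edges H) (edges K) e∈))
  }

module _ (G : Graph n m) where
  open Graph G

  touches? : (X : Subset m) → Decidable (λ v → ∃[ e ] (e ∈ X × Incident e v))
  touches? X v = any? λ e → (e ∈? X) ×-dec incident? e v

  _⟨_⟩ : Subset m → Subgraph G
  _⟨_⟩ X = record
    { verts  = select (touches? X)
    ; edges  = X
    ; closed = λ e∈ i → ∈-select⁺ (touches? X) (_ , e∈ , i)
    }

Δ : Subgraph G → ℤ
Δ H = ∣ edges H ∣ ⊖ ∣ verts H ∣

module _ {G : Graph n m} where
  open Graph G

  Adjacent : Subgraph G → Fin n → Fin n → Set
  Adjacent H u v = ∃[ e ] (e ∈ edges H × Joins e u v)

  Reachable : Subgraph G → Fin n → Fin n → Set
  Reachable H = Star (Adjacent H)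

  private
    Adjˡ : List (Fin m) → Fin n → Fin n → Set
    Adjˡ es u v = Any (λ e → Joins e u v) es

    module _ (e : Fin m) (es : List (Fin m)) where
      a b : Fin n
      a = source e
      b = target e

      S : Fin n → Fin n → Set
      S = Star (Adjˡ es)

      Via : Fin n → Fin n → Set
      Via u v = S u v ⊎ ((S u a × S b v) ⊎ (S u b × S a v))

      weaken : ∀ {u v} → S u v → Star (Adjˡ (e ∷ es)) u v
      weaken = gmap (λ x → x) there

      via⇒ : ∀ {u v} → Via u v → Star (Adjˡ (e ∷ es)) u v
      via⇒ (inj₁ p)              = weaken p
      via⇒ (inj₂ (inj₁ (p , q))) = weaken p ◅◅ here (inj₁ refl) ◅ weaken q
      via⇒ (inj₂ (inj₂ (p , q))) = weaken p ◅◅ here (inj₂ refl) ◅ weaken q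

      ⇒via : ∀ {u v} → Star (Adjˡ (e ∷ es)) u v → Via u v
      ⇒via ε = inj₁ ε
      ⇒via (here (inj₁ refl) ◅ r) with ⇒via r
      ... | inj₁ p              = inj₂ (inj₁ (ε , p))
      ... | inj₂ (inj₁ (_ , q)) = inj₂ (inj₁ (ε , q))
      ... | inj₂ (inj₂ (_ , q)) = inj₁ q
      ⇒via (here (inj₂ refl) ◅ r) with ⇒via r
      ... | inj₁ p              = inj₂ (inj₂ (ε , p))
      ... | inj₂ (inj₁ (_ , q)) = inj₁ q
      ... | inj₂ (inj₂ (_ , q)) = inj₂ (inj₂ (ε , q))
      ⇒via (there s ◅ r) with ⇒via r
      ... | inj₁ p              = inj₁ (s ◅ p)
      ... | inj₂ (inj₁ (p , q)) = inj₂ (inj₁ (s ◅ p , q))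
      ... | inj₂ (inj₂ (p , q)) = inj₂ (inj₂ (s ◅ p , q))

    starˡ? : ∀ es u v → Dec (Star (Adjˡ es) u v)
    starˡ? [] u v = map′ (λ { refl → ε }) (λ { ε → refl }) (u ≟ᶠ v)
    starˡ? (e ∷ es) u v = map′ (via⇒ e es) (⇒via e es)
      (starˡ? es u v ⊎-dec ((starˡ? es u (source e) ×-dec starˡ? es (target e) v)
                       ⊎-dec (starˡ? es u (target e) ×-dec starˡ? es (source e) v)))

  reachable? : ∀ H u v → Dec (Reachable H u v)
  reachable? H u v = map′ (gmap (λ x → x) to) (gmap (λ x → x) from) (starˡ? es u v)
    where
    es = filter (_∈? edges H) (allFin m)
    to : ∀ {u v} → Adjˡ es u v → Adjacent H u v
    to p = let (e , e∈ , j) = find p in e , proj₂ (∈-filter⁻ (_∈? edges H) {xs = allFin m} e∈) , j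
    from : ∀ {u v} → Adjacent H u v → Adjˡ es u v
    from (e , e∈ , j) = lose (∈-filter⁺ (_∈? edges H) (∈-allFin e) e∈) j

  Connected : Subgraph G → Set
  Connected H = Nonempty (verts H) × (∀ u v → u ∈ verts H → v ∈ verts H → Reachable H u v)

  connected? : Decidable Connected
  connected? H = nonempty? (verts H) ×-dec
    all? λ u → all? λ v → (u ∈? verts H) →-dec ((v ∈? verts H) →-dec reachable? H u v)

  component : Subgraph G → Fin n → Subgraph G
  component H v = record
    { verts  = select inV?
    ; edges  = select inE?
    ; closed = λ {e} e∈ i → let (e∈H , r) = ∈-select⁻ inE? e∈
                            in ∈-select⁺ inV? (closed H e∈H i , extend e∈H r i)
    }
    where
    inV? : Decidable (λ u → u ∈ verts H × Reachable H v u)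
    inV? u = (u ∈? verts H) ×-dec reachable? H v u
    inE? : Decidable (λ e → e ∈ edges H × Reachable H v (source e))
    inE? e = (e ∈? edges H) ×-dec reachable? H v (source e)
    extend : ∀ {e w} → e ∈ edges H → Reachable H v (source e) → Incident e w → Reachable H v w
    extend e∈ r (inj₁ refl) = r
    extend e∈ r (inj₂ refl) = r ◅◅ (_ , e∈ , inj₁ refl) ◅ ε

  -- Components with the same vertices are the same, so each one is listed once.
  components : Subgraph G → List (Subgraph G)
  components H =
    deduplicate (λ A B → Vec-≡-dec _≟ᵇ_ (verts A) (verts B))
      (map (component H) (filter (_∈? verts H) (allFin n)))

  -- a loop counts twice
  degree : Subgraph G → Fin n → ℕ
  degree H v = ∣ select (λ e → (e ∈? edges H) ×-dec (v ≟ᶠ source e)) ∣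
             + ∣ select (λ e → (e ∈? edges H) ×-dec (v ≟ᶠ target e)) ∣

  Cycle : Subgraph G → Set
  Cycle H = Connected H × (∀ v → v ∈ verts H → degree H v ≡ 2)

  cycle? : Decidable Cycle
  cycle? H = connected? H ×-dec all? λ v → (v ∈? verts H) →-dec (degree H v ℕ.≟ 2)

  HasCycle : Subgraph G → Set
  HasCycle H = ∃[ C ] (C ⊆ edges H × Cycle (G ⟨ C ⟩))

  Tree : Subgraph G → Set
  Tree H = Connected H × ¬ HasCycle H

  tree? : Decidable Tree
  tree? H = connected? H ×-dec ¬? (anySubset? λ C → (C ⊆? edges H) ×-dec cycle? (G ⟨ C ⟩))

  t : Subgraph G → ℕ
  t H = length (filter tree? (components H))

  Leaf : Subgraph G → Fin n → Set
  Leaf H v = v ∈ verts H × ∃[ e ] ((e ∈ edges H × Incident e v × ¬ Loop e)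
                                   × (∀ f → f ∈ edges H → Incident f v → f ≡ e))

  leaf? : ∀ H → Decidable (Leaf H)
  leaf? H v = (v ∈? verts H) ×-dec any? λ e →
    ((e ∈? edges H) ×-dec (incident? e v ×-dec ¬? (source e ≟ᶠ target e)))
    ×-dec all? λ f → (f ∈? edges H) →-dec (incident? f v →-dec (f ≟ᶠ e))

  -- deletes one leaf, if there is one
  prune : Subgraph G → Subgraph G
  prune H with any? (leaf? H)
  ... | yes (v , _) = H ∖ᵥ v
  ... | no _        = H

  -- n rounds are enough to remove every leaf: see kernel-leafless.
  kernel : Subgraph G → Subgraph G
  kernel A = iterate prune A n

  private
    iterate-leafless : ∀ f H → ∣ verts H ∣ ≤ f → ¬ ∃ (Leaf (iterate prune H f))
    iterate-leafless zero H ∣H∣≤0 (v , v∈ , _) with ≤-trans (x∈p⇒∣p-x∣<∣p∣ v∈) ∣H∣≤0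
    ... | ()
    iterate-leafless (suc f) H ∣H∣≤ with any? (leaf? H)
    ... | yes (v , v∈ , _) =
      iterate-leafless f (H ∖ᵥ v) (s≤s⁻¹ (≤-trans (x∈p⇒∣p-x∣<∣p∣ v∈) ∣H∣≤))
    ... | no ¬leaf = subst (λ K → ¬ ∃ (Leaf K)) (sym (stay f)) ¬leaf
      where
      prune-id : prune H ≡ H
      prune-id with any? (leaf? H)
      ... | yes l = ⊥-elim (¬leaf l)
      ... | no _  = refl
      stay : ∀ f → iterate prune H f ≡ H
      stay zero    = refl
      stay (suc f) = trans (cong (λ K → iterate prune K f) prune-id) (stay f)

  kernel-leafless : ∀ A → ¬ ∃ (Leaf (kernel A))
  kernel-leafless A = iterate-leafless n A (∣p∣≤n (verts A))

core : (G : Graph n m) → Subgraph G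
core G = foldr _∪ᴳ_ ∅ᴳ (map kernel (filter (λ A → 1ℤ ℤ.≤? Δ A) (components (whole G))))

Y : (G : Graph n m) → Pred (Fin m) 0ℓ
Y G e = t (whole G ∖ₑ e) > t (whole G)

∣p∪q∣+∣p∩q∣ : (p q : Subset n) → ∣ p ∪ q ∣ + ∣ p ∩ q ∣ ≡ ∣ p ∣ + ∣ q ∣
∣p∪q∣+∣p∩q∣ [] [] = refl
∣p∪q∣+∣p∩q∣ (outside ∷ p) (outside ∷ q) = ∣p∪q∣+∣p∩q∣ p q
∣p∪q∣+∣p∩q∣ (inside ∷ p) (outside ∷ q) = cong suc (∣p∪q∣+∣p∩q∣ p q)
∣p∪q∣+∣p∩q∣ (outside ∷ p) (inside ∷ q) =
  trans (cong suc (∣p∪q∣+∣p∩q∣ p q)) (sym (+-suc ∣ p ∣ ∣ q ∣))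
∣p∪q∣+∣p∩q∣ (inside ∷ p) (inside ∷ q) = cong suc
  (trans (+-suc _ _) (trans (cong suc (∣p∪q∣+∣p∩q∣ p q)) (sym (+-suc ∣ p ∣ ∣ q ∣))))

minimal-below : {P : Pred (Subset n) 0ℓ} → Decidable P →
                ∀ {X} → P X → ∃[ C ] (Minimal P C × C ⊆ X)
minimal-below {P = P} P? px = go px (<-wellFounded _)
  where
  go : ∀ {X} → P X → Acc _<_ ∣ X ∣ → ∃[ C ] (Minimal P C × C ⊆ X)
  go {X} px (acc rs) with anySubset? (λ Z → P? Z ×-dec (Z ⊂? X))
  ... | yes (Z , pz , Z⊂X) =
    let (C , min , C⊆Z) = go pz (rs (p⊂q⇒∣p∣<∣q∣ Z⊂X)) in C , min , λ x∈ → proj₁ Z⊂X (C⊆Z x∈)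
  ... | no none = X , (px , λ {Z} pz Z⊆X {x} x∈X → in-Z pz Z⊆X x∈X) , λ x∈ → x∈
    where
    in-Z : ∀ {Z x} → P Z → Z ⊆ X → x ∈ X → x ∈ Z
    in-Z {Z} {x} pz Z⊆X x∈X with x ∈? Z
    ... | yes x∈Z = x∈Z
    ... | no x∉Z = ⊥-elim (none (Z , pz , (λ {y} → Z⊆X {y}) , x , x∈X , x∉Z))

module _ (k : ℕ) (G : Graph n m) where
  open Graph G

  Dense : Pred (Subset m) 0ℓ
  Dense C = Nonempty C × ∣ C ∣ ≡ ∣ verts (G ⟨ C ⟩) ∣ + k

  V : Subset m → Subset n
  V X = verts (G ⟨ X ⟩)

  dense? : Decidable Dense
  dense? C = nonempty? C ×-dec (∣ C ∣ ℕ.≟ ∣ V C ∣ + k)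

  V-mono : ∀ {X Z} → X ⊆ Z → V X ⊆ V Z
  V-mono {X} {Z} X⊆Z v∈ = let (e , e∈ , i) = ∈-select⁻ (touches? G X) v∈
                          in ∈-select⁺ (touches? G Z) (e , X⊆Z e∈ , i)

  V-∪ : ∀ X Z → V (X ∪ Z) ⊆ V X ∪ V Z
  V-∪ X Z v∈ with ∈-select⁻ (touches? G (X ∪ Z)) v∈
  ... | e , e∈ , i with x∈p∪q⁻ X Z e∈
  ... | inj₁ h = x∈p∪q⁺ (inj₁ (∈-select⁺ (touches? G X) (e , h , i)))
  ... | inj₂ h = x∈p∪q⁺ (inj₂ (∈-select⁺ (touches? G Z) (e , h , i)))

  V-∩ : ∀ X Z → V (X ∩ Z) ⊆ V X ∩ V Z
  V-∩ X Z v∈ = x∈p∩q⁺ (V-mono (p∩q⊆p X Z) v∈ , V-mono (p∩q⊆q X Z) v∈)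

  V-sub : ∀ X Z → ∣ V (X ∪ Z) ∣ + ∣ V (X ∩ Z) ∣ ≤ ∣ V X ∣ + ∣ V Z ∣
  V-sub X Z = ≤-trans (+-mono-≤ (p⊆q⇒∣p∣≤∣q∣ (V-∪ X Z)) (p⊆q⇒∣p∣≤∣q∣ (V-∩ X Z)))
                      (≤-reflexive (∣p∪q∣+∣p∩q∣ (V X) (V Z)))

  0<∣_∣ : ∀ {l} {X : Subset l} {x} → x ∈ X → 0 < ∣ X ∣
  0<∣ x∈ ∣ = ≤-trans (s≤s z≤n) (x∈p⇒∣p-x∣<∣p∣ x∈)

  nonempty : ∀ {l} {X : Subset l} → 0 < ∣ X ∣ → Nonempty X
  nonempty {l} {X} 0< with nonempty? X
  ... | yes ne = ne
  ... | no ¬ne with ≤-trans 0< (≤-reflexive (trans (cong ∣_∣ (Empty-unique ¬ne)) (∣⊥∣≡0 l)))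
  ...   | ()

  ∣p∣≤1+∣p-x∣ : ∀ {l} (X : Subset l) x → ∣ X ∣ ≤ suc ∣ X - x ∣
  ∣p∣≤1+∣p-x∣ X x = begin
    ∣ X ∣                    ≤⟨ p⊆q⇒∣p∣≤∣q∣ cover ⟩
    ∣ ⁅ x ⁆ ∪ (X - x) ∣      ≤⟨ m≤m+n _ _ ⟩
    ∣ ⁅ x ⁆ ∪ (X - x) ∣ + ∣ ⁅ x ⁆ ∩ (X - x) ∣ ≡⟨ ∣p∪q∣+∣p∩q∣ ⁅ x ⁆ (X - x) ⟩
    ∣ ⁅ x ⁆ ∣ + ∣ X - x ∣    ≡⟨ cong (_+ ∣ X - x ∣) (∣⁅x⁆∣≡1 x) ⟩
    suc ∣ X - x ∣            ∎
    where
    open ≤-Reasoning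
    cover : X ⊆ ⁅ x ⁆ ∪ (X - x)
    cover {y} y∈ with y ≟ᶠ x
    ... | yes refl = x∈p∪q⁺ (inj₁ (x∈⁅x⁆ x))
    ... | no y≢x   = x∈p∪q⁺ (inj₂ (x∈p∧x≢y⇒x∈p-y y∈ y≢x))

  dense-below : ∀ X → Nonempty X → ∣ V X ∣ + k ≤ ∣ X ∣ → ∃[ C ] (Dense C × C ⊆ X)
  dense-below X ne le = go X ne le (<-wellFounded _)
    where
    go : ∀ X → Nonempty X → ∣ V X ∣ + k ≤ ∣ X ∣ → Acc _<_ ∣ X ∣ → ∃[ C ] (Dense C × C ⊆ X)
    go X ne@(x , x∈) le (acc rs) with m≤n⇒m<n∨m≡n le
    ... | inj₂ eq = X , (ne , sym eq) , λ y∈ → y∈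
    ... | inj₁ lt =
      let X-x⊆X = p─q⊆p X ⁅ x ⁆
          lt′ : suc (∣ V X ∣ + k) ≤ suc ∣ X - x ∣
          lt′ = ≤-trans lt (∣p∣≤1+∣p-x∣ X x)
          0<V = 0<∣ ∈-select⁺ (touches? G X) {source x} (x , x∈ , inj₁ refl) ∣
          (C , d , C⊆) = go (X - x)
            (nonempty (≤-trans 0<V (≤-trans (m≤m+n _ k) (s≤s⁻¹ lt′))))
            (≤-trans (+-monoˡ-≤ k (p⊆q⇒∣p∣≤∣q∣ (V-mono X-x⊆X))) (s≤s⁻¹ lt′))
            (rs (x∈p⇒∣p-x∣<∣p∣ x∈))
      in C , d , λ y∈ → X-x⊆X (C⊆ y∈)

  incomparable : ∀ {C D} → Minimal Dense C → Minimal Dense D → C ⊆ D → C ≡ D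
  incomparable (dC , _) (_ , minD) C⊆D = ⊆-antisym C⊆D (minD dC C⊆D)

  sparse : ∀ {C X} → Minimal Dense C → X ⊆ C → Nonempty X → ¬ (C ⊆ X) → ∣ X ∣ < ∣ V X ∣ + k
  sparse {C} {X} (_ , minC) X⊆C ne C⊈X = ≰⇒> λ le →
    let (D , dD , D⊆X) = dense-below X ne le
    in C⊈X λ x∈ → D⊆X (minC dD (λ y∈ → X⊆C (D⊆X y∈)) x∈)

  arith : ∀ {u i vu vi c d vc vd} → u + i ≡ c + d → vu + vi ≤ vc + vd →
          c ≡ vc + k → d ≡ vd + k → i < vi + k → vu + k < u
  arith {u} {i} {vu} {vi} {c} {d} {vc} {vd} e₁ le e₂ e₃ lt = +-cancelʳ-≤ i _ _ (begin
    suc (vu + k) + i     ≡⟨ sym (+-suc (vu + k) i) ⟩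
    vu + k + suc i       ≤⟨ +-monoʳ-≤ (vu + k) lt ⟩
    vu + k + (vi + k)    ≡⟨ shuffle vu vi k ⟩
    vu + vi + (k + k)    ≤⟨ +-monoˡ-≤ (k + k) le ⟩
    vc + vd + (k + k)    ≡⟨ sym (shuffle vc vd k) ⟩
    vc + k + (vd + k)    ≡⟨ sym (cong₂ _+_ e₂ e₃) ⟩
    c + d                ≡⟨ sym e₁ ⟩
    u + i                ∎)
    where
    open ≤-Reasoning
    shuffle : ∀ a b k → a + k + (b + k) ≡ a + b + (k + k)
    shuffle = solve-∀

  elimination : ∀ {C D e} → Minimal Dense C → Minimal Dense D → C ≢ D → e ∈ C → e ∈ D →
                ∃[ F ] (Minimal Dense F × F ⊆ (C ∪ D) - e)
  elimination {C} {D} {e} mC@((_ , cC) , minC) mD@((_ , cD) , _) C≢D e∈C e∈D =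
    let (Z , dZ , Z⊆) = dense-below U-e
          (nonempty (≤-trans (≤-trans 0<V (m≤m+n _ k)) (s≤s⁻¹ lt′)))
          (≤-trans (+-monoˡ-≤ k (p⊆q⇒∣p∣≤∣q∣ (V-mono (p─q⊆p (C ∪ D) ⁅ e ⁆)))) (s≤s⁻¹ lt′))
        (F , mF , F⊆) = minimal-below dense? dZ
    in F , mF , λ x∈ → Z⊆ (F⊆ x∈)
    where
    U-e = (C ∪ D) - e
    C⊈C∩D : ¬ (C ⊆ C ∩ D)
    C⊈C∩D h = C≢D (incomparable mC mD λ x∈ → p∩q⊆q C D (h x∈))
    lt : ∣ V (C ∪ D) ∣ + k < ∣ C ∪ D ∣
    lt = arith {i = ∣ C ∩ D ∣} {vi = ∣ V (C ∩ D) ∣} (∣p∪q∣+∣p∩q∣ C D) (V-sub C D) cC cD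
           (sparse mC (p∩q⊆p C D) (e , x∈p∩q⁺ (e∈C , e∈D)) C⊈C∩D)
    lt′ : suc (∣ V (C ∪ D) ∣ + k) ≤ suc ∣ U-e ∣
    lt′ = ≤-trans lt (∣p∣≤1+∣p-x∣ (C ∪ D) e)
    0<V : 0 < ∣ V (C ∪ D) ∣
    0<V = 0<∣ ∈-select⁺ (touches? G (C ∪ D)) {source e} (e , p⊆p∪q D e∈C , inj₁ refl) ∣

  M : Matroid m
  M = record
    { Circuit              = Minimal Dense
    ; circuit-nonempty     = λ c → proj₁ (proj₁ c)
    ; circuit-incomparable = incomparable
    ; circuit-elimination  = elimination
    }

-- The excess ∣X∣ - ∣V(X)∣ of an edge set X is a supermodular function of X. Call C critical
-- if all its proper subsets have smaller excess. For k ≥ 1 the circuits of M_k are the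
-- critical sets of excess k, and an edge of some critical set lies in a circuit: the largest
-- critical set contains it, and the excess can be lowered in unit steps while keeping the
-- edge. The core is the union of the critical sets, since pruning a leaf never removes an
-- edge of a critical set, and a connected leafless subgraph of positive excess is critical.
-- Finally t(H) + ∣E(H)∣ - ∣V(H)∣ is the largest excess of a subset of E(H), so deleting e
-- raises t exactly when the largest excess is attained without e, that is, when e lies in
-- no critical set.

module Submission where

open import Defs
open import Data.Bool using (Bool; true; false) renaming (_≟_ to _≟ᵇ_)
open import Data.Empty using (⊥-elim)
open import Data.Fin using (Fin; zero; suc) renaming (_≟_ to _≟ᶠ_)
open import Data.Fin.Properties using (any?)
open import Data.Fin.Subset
open import Data.Fin.Subset.Properties
open import Data.Integer as ℤ using (1ℤ; _⊖_; +≤+)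
import Data.Integer.Properties as ℤ
open import Data.List as List using (List; []; _∷_)
open import Data.List.Membership.Propositional using (find; lose)
open import Data.List.Membership.Propositional.Properties using (∈-filter⁺; ∈-filter⁻; ∈-allFin)
open import Data.List.Relation.Unary.All as All using (All; []; _∷_)
import Data.List.Relation.Unary.All.Properties as All
open import Data.List.Relation.Unary.AllPairs using (AllPairs; []; _∷_)
open import Data.List.Relation.Unary.Any using (Any; here; there)
import Data.List.Relation.Unary.Any.Properties as Any
import Data.List.Relation.Unary.Unique.DecSetoid.Properties as Unique
open import Data.Nat using (ℕ; zero; suc; _+_; _≤_; _<_; z≤n; s≤s; s≤s⁻¹; _≤?_)
open import Data.Nat.GeneralisedArithmetic using (iterate)
import Data.Nat.ListAction as ListAction
open import Data.Nat.Properties hiding (_≟_; _≤?_)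
open import Data.Product using (_×_; _,_; ∃-syntax; proj₁; proj₂)
open import Data.Sum using (_⊎_; inj₁; inj₂; [_,_]′)
open import Data.Vec using ([]; _∷_; tabulate; here; there)
open import Data.Vec.Properties using () renaming (≡-dec to Vec-≡-dec)
open import Function using (_∘_)
open import Level using (0ℓ)
open import Relation.Binary.Construct.Closure.ReflexiveTransitive using (ε; _◅_; _◅◅_; reverse)
import Relation.Binary.Construct.On as On
open import Relation.Binary.PropositionalEquality
open import Relation.Binary.PropositionalEquality.Properties using (decSetoid)
open import Relation.Nullary using (¬_; Dec; yes; no; does; contradiction)
open import Relation.Nullary.Decidable using (_×-dec_; ¬?; decidable-stable)
open import Relation.Unary using (Pred; Decidable; _≐_)

open import Algebra.Properties.CommutativeMonoid.Sum +-0-commutativeMonoid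
  using (sum; sum-cong-≗; ∑-comm; ∑-distrib-+)
open import Algebra.Solver.CommutativeMonoid +-0-commutativeMonoid using (_⊕_; _⊜_; solve)

-- The core and `Y` do not mention k, so circuits of excess exactly k are hard to compare with them
-- directly; criticality is what remains of being a circuit when k is forgotten. The price is paid
-- in one direction only: an edge of a critical set C has to be put into a circuit of the prescribed
-- excess, although C itself may have excess below k. Passing to a set of maximal excess repairs
-- this, because that maximum is at least k as soon as one circuit exists. The formula for t comes
-- from the components. A tree has one vertex more than edges, so dropping it gains 1; every other
-- component has excess at least 0 and is best kept whole. That no other choice does better rests on
-- a growth principle: in a connected subgraph, each vertex outside a vertex set that meets it can
-- be charged to an edge of its own, with an edge to spare if there are no leaves and some vertex is
-- outside. The same principle yields the criticality of kernels.

private variable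
  n m : ℕ
  Elem : Set
  xs : List Elem

-- The format of all counting arguments below: the hypotheses are added up to `l ≤ r`, and what
-- remains is an identity for the monoid solver. The 1 of a strict inequality enters such an
-- identity as the variable `o`.
linear : ∀ {l r} a b → l ≤ r → a + r ≡ b + l → a ≤ b
linear {l} a b l≤r eq = +-cancelʳ-≤ l a b (≤-trans (+-monoʳ-≤ a l≤r) (≤-reflexive eq))

-- Cardinalities of subsets

x∈p─q⇒x∉q : ∀ {x} (p q : Subset n) → x ∈ p ─ q → x ∉ q
x∈p─q⇒x∉q (_ ∷ _) (outside ∷ _) here ()
x∈p─q⇒x∉q (_ ∷ p) (_ ∷ q) (there x∈) (there x∈q) = x∈p─q⇒x∉q p q x∈ x∈q

⊈⇒∃ : ∀ {p q : Subset n} → p ⊈ q → ∃[ x ] (x ∈ p × x ∉ q)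
⊈⇒∃ {p = p} {q} p⊈q with nonempty? (p ─ q)
... | yes (x , x∈) = x , p─q⊆p p q x∈ , x∈p─q⇒x∉q p q x∈
... | no empty = ⊥-elim (p⊈q p⊆q)
  where
  p⊆q : p ⊆ q
  p⊆q {x} x∈p with x ∈? q
  ... | yes x∈q = x∈q
  ... | no x∉q  = contradiction (x , x∈p∧x∉q⇒x∈p─q x∈p x∉q) empty

∣cover∣ : ∀ (r p q : Subset n) → (∀ {x} → x ∈ r → x ∈ p ⊎ x ∈ q) → ∣ r ∣ ≤ ∣ p ∣ + ∣ q ∣
∣cover∣ r p q r⊆ = begin
  ∣ r ∣                  ≤⟨ p⊆q⇒∣p∣≤∣q∣ (λ x∈ → x∈p∪q⁺ (r⊆ x∈)) ⟩
  ∣ p ∪ q ∣              ≤⟨ m≤m+n _ _ ⟩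
  ∣ p ∪ q ∣ + ∣ p ∩ q ∣  ≡⟨ ∣p∪q∣+∣p∩q∣ p q ⟩
  ∣ p ∣ + ∣ q ∣          ∎
  where open ≤-Reasoning

∣pack∣ : ∀ (r p q : Subset n) → p ⊆ r → q ⊆ r → (∀ {x} → x ∈ p → x ∉ q) → ∣ p ∣ + ∣ q ∣ ≤ ∣ r ∣
∣pack∣ {n} r p q p⊆r q⊆r disjoint = begin
  ∣ p ∣ + ∣ q ∣          ≡⟨ ∣p∪q∣+∣p∩q∣ p q ⟨
  ∣ p ∪ q ∣ + ∣ p ∩ q ∣  ≡⟨ cong (λ s → ∣ p ∪ q ∣ + ∣ s ∣) p∩q≡⊥ ⟩
  ∣ p ∪ q ∣ + ∣ ⊥ {n} ∣  ≡⟨ cong (∣ p ∪ q ∣ +_) (∣⊥∣≡0 n) ⟩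
  ∣ p ∪ q ∣ + 0          ≡⟨ +-identityʳ _ ⟩
  ∣ p ∪ q ∣              ≤⟨ p⊆q⇒∣p∣≤∣q∣ (λ x∈ → [ p⊆r , q⊆r ]′ (x∈p∪q⁻ p q x∈)) ⟩
  ∣ r ∣                  ∎
  where
  open ≤-Reasoning
  p∩q≡⊥ : p ∩ q ≡ ⊥
  p∩q≡⊥ = Empty-unique λ (_ , x∈) → let (x∈p , x∈q) = x∈p∩q⁻ p q x∈ in disjoint x∈p x∈q

∈-or-─ : ∀ {x} {p : Subset n} (q : Subset n) → x ∈ p → x ∈ q ⊎ x ∈ p ─ q
∈-or-─ {x = x} q x∈p with x ∈? q
... | yes x∈q = inj₁ x∈q
... | no x∉q  = inj₂ (x∈p∧x∉q⇒x∈p─q x∈p x∉q)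

∣p∣≤∣q∣+∣p─q∣ : ∀ (p q : Subset n) → ∣ p ∣ ≤ ∣ q ∣ + ∣ p ─ q ∣
∣p∣≤∣q∣+∣p─q∣ p q = ∣cover∣ p q (p ─ q) (∈-or-─ q)

∣q∣+∣p─q∣≤∣p∣ : ∀ (p q : Subset n) → q ⊆ p → ∣ q ∣ + ∣ p ─ q ∣ ≤ ∣ p ∣
∣q∣+∣p─q∣≤∣p∣ p q q⊆p = ∣pack∣ p q (p ─ q) q⊆p (p─q⊆p p q) (λ x∈q x∈ → x∈p─q⇒x∉q p q x∈ x∈q)

x∉p-x : ∀ (p : Subset n) x → x ∉ p - x
x∉p-x p x x∈ = x∈p─q⇒x∉q p ⁅ x ⁆ x∈ (x∈⁅x⁆ x)

1+∣p∣≤∣r∣ : ∀ {x} {p r : Subset n} → p ⊆ r → x ∈ r → x ∉ p → suc ∣ p ∣ ≤ ∣ r ∣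
1+∣p∣≤∣r∣ {x = x} {p} p⊆r x∈r x∉p = p⊂q⇒∣p∣<∣q∣ {p = p} (p⊆r , x , x∈r , x∉p)

∣p∣≤1+∣q∣ : ∀ {x} {p q : Subset n} → (∀ {y} → y ∈ p → y ≢ x → y ∈ q) → ∣ p ∣ ≤ suc ∣ q ∣
∣p∣≤1+∣q∣ {x = x} {p} {q} h =
  subst (λ c → ∣ p ∣ ≤ c + ∣ q ∣) (∣⁅x⁆∣≡1 x) (∣cover∣ p ⁅ x ⁆ q split)
  where
  split : ∀ {y} → y ∈ p → y ∈ ⁅ x ⁆ ⊎ y ∈ q
  split {y} y∈ with y ≟ᶠ x
  ... | yes refl = inj₁ (x∈⁅x⁆ x)
  ... | no y≢x   = inj₂ (h y∈ y≢x)

Empty⇒∣p∣≡0 : ∀ {p : Subset n} → ¬ Nonempty p → ∣ p ∣ ≡ 0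
Empty⇒∣p∣≡0 {n} empty = trans (cong ∣_∣ (Empty-unique empty)) (∣⊥∣≡0 n)

0<∣p∣⇒Nonempty : ∀ {p : Subset n} → 0 < ∣ p ∣ → Nonempty p
0<∣p∣⇒Nonempty {p = p} 0< with nonempty? p
... | yes ne = ne
... | no empty = contradiction (Empty⇒∣p∣≡0 empty) (>⇒≢ 0<)

-- Critical edge sets and circuits

module Excess (G : Graph n m) where
  open Graph G

  vs : Subset m → Subset n
  vs X = verts (G ⟨ X ⟩)

  infix 4 _≺_ _≼_

  -- comparison of the excesses ∣ X ∣ - ∣ vs X ∣, avoiding subtraction
  _≺_ _≼_ : Subset m → Subset m → Set
  X ≺ Z = ∣ X ∣ + ∣ vs Z ∣ < ∣ Z ∣ + ∣ vs X ∣
  X ≼ Z = ∣ X ∣ + ∣ vs Z ∣ ≤ ∣ Z ∣ + ∣ vs X ∣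

  -- The empty set is critical vacuously; every other critical set has positive excess, by
  -- comparison with the empty set.
  Critical : Pred (Subset m) 0ℓ
  Critical C = ∀ Z → Z ⊆ C → C ⊈ Z → Z ≺ C

  ∈vs⁺ : ∀ {X e v} → e ∈ X → Incident e v → v ∈ vs X
  ∈vs⁺ {X} e∈ i = ∈-select⁺ (touches? G X) (_ , e∈ , i)

  ∈vs⁻ : ∀ X {v} → v ∈ vs X → ∃[ e ] (e ∈ X × Incident e v)
  ∈vs⁻ X = ∈-select⁻ (touches? G X)

  vs-mono : ∀ {X Z} → X ⊆ Z → ∣ vs X ∣ ≤ ∣ vs Z ∣
  vs-mono {X} {Z} X⊆Z = p⊆q⇒∣p∣≤∣q∣ (V-mono 0 G {X} {Z} X⊆Z)

  ≼-trans : ∀ {X Y Z} → X ≼ Y → Y ≼ Z → X ≼ Z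
  ≼-trans {X} {Y} {Z} = lemma (∣ X ∣) (∣ Y ∣) (∣ Z ∣) (∣ vs X ∣) (∣ vs Y ∣) (∣ vs Z ∣)
    where
    lemma : ∀ x y z a b c → x + b ≤ y + a → y + c ≤ z + b → x + c ≤ z + a
    lemma x y z a b c p q = linear _ _ (+-mono-≤ p q)
      (solve 6 (λ x y z a b c → (x ⊕ c) ⊕ ((y ⊕ a) ⊕ (z ⊕ b)) ⊜ (z ⊕ a) ⊕ ((x ⊕ b) ⊕ (y ⊕ c)))
        refl x y z a b c)

  -- Supermodularity: the excess gained from `W` to `W ∪ C` is at least that gained from `W ∩ C` to
  -- `C`, which is positive because `W ∩ C` is a proper subset of `C`.
  critical-≺-∪ : ∀ {C} → Critical C → ∀ W → C ⊈ W → W ≺ W ∪ C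
  critical-≺-∪ {C} crit W C⊈W =
    lemma (∣ W ∣) (∣ C ∣) (∣ W ∪ C ∣) (∣ W ∩ C ∣)
          (∣ vs W ∣) (∣ vs C ∣) (∣ vs (W ∪ C) ∣) (∣ vs (W ∩ C) ∣)
      (crit (W ∩ C) (p∩q⊆q W C) (λ C⊆ → C⊈W λ x∈ → p∩q⊆p W C (C⊆ x∈)))
      (V-sub 0 G W C)
      (≤-reflexive (sym (∣p∪q∣+∣p∩q∣ W C)))
    where
    lemma : ∀ w c u i vw vc vu vi → 1 + (i + vc) ≤ c + vi → vu + vi ≤ vw + vc →
            w + c ≤ u + i → 1 + (w + vu) ≤ u + vw
    lemma w c u i vw vc vu vi p q r = linear _ _ (+-mono-≤ (+-mono-≤ p q) r)
      (solve 9 (λ o w c u i vw vc vu vi →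
          (o ⊕ (w ⊕ vu)) ⊕ (((c ⊕ vi) ⊕ (vw ⊕ vc)) ⊕ (u ⊕ i))
        ⊜ (u ⊕ vw) ⊕ (((o ⊕ (i ⊕ vc)) ⊕ (vu ⊕ vi)) ⊕ (w ⊕ c)))
        refl 1 w c u i vw vc vu vi)

  -- Take `C` inclusion-minimal among the subsets of `W` with at least the excess of `W`: a proper
  -- subset of `C` has less excess than `W`, hence less than `C`.
  critical-below : ∀ W → ∃[ C ] (Critical C × C ⊆ W × W ≼ C)
  critical-below W =
    let (C , (W≼C , min) , C⊆W) = minimal-below W≼? (≤-refl {∣ W ∣ + ∣ vs W ∣})
        crit : Critical C
        crit Z Z⊆C C⊈Z =
          lemma (∣ Z ∣) (∣ W ∣) (∣ C ∣) (∣ vs Z ∣) (∣ vs W ∣) (∣ vs C ∣)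
            (≰⇒> λ W≼Z → C⊈Z (min W≼Z Z⊆C)) W≼C
    in C , crit , C⊆W , W≼C
    where
    W≼? : Decidable (W ≼_)
    W≼? Z = ∣ W ∣ + ∣ vs Z ∣ ≤? ∣ Z ∣ + ∣ vs W ∣
    lemma : ∀ z w c vz vw vc → 1 + (z + vw) ≤ w + vz → w + vc ≤ c + vw → 1 + (z + vc) ≤ c + vz
    lemma z w c vz vw vc p q = linear _ _ (+-mono-≤ p q)
      (solve 7 (λ o z w c vz vw vc → (o ⊕ (z ⊕ vc)) ⊕ ((w ⊕ vz) ⊕ (c ⊕ vw))
                                   ⊜ (c ⊕ vz) ⊕ ((o ⊕ (z ⊕ vw)) ⊕ (w ⊕ vc)))
        refl 1 z w c vz vw vc)

  module _ {k} (1≤k : 1 ≤ k) where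

    -- `sparse` handles the nonempty proper subsets. The empty set has excess 0, which is below k
    -- because k ≥ 1.
    circuit⇒critical : ∀ {C} → Minimal (Dense k G) C → Critical C
    circuit⇒critical {C} min@((_ , ∣C∣≡) , _) Z Z⊆C C⊈Z with nonempty? Z
    ... | no empty rewrite Empty⇒∣p∣≡0 empty | ∣C∣≡ =
      ≤-trans (≤-reflexive (+-comm 1 ∣ vs C ∣)) (≤-trans (+-monoʳ-≤ ∣ vs C ∣ 1≤k) (m≤m+n _ _))
    ... | yes ne rewrite ∣C∣≡ =
      lemma (∣ Z ∣) (∣ vs Z ∣) (∣ vs C ∣) k (sparse k G min Z⊆C ne C⊈Z)
      where
      lemma : ∀ z vz vc k → 1 + z ≤ vz + k → 1 + (z + vc) ≤ vc + k + vz
      lemma z vz vc k p = linear _ _ p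
        (solve 5 (λ o z vz vc k → (o ⊕ (z ⊕ vc)) ⊕ (vz ⊕ k) ⊜ ((vc ⊕ k) ⊕ vz) ⊕ (o ⊕ z))
          refl 1 z vz vc k)

    critical⇒circuit : ∀ {C} → Critical C → ∣ C ∣ ≡ ∣ vs C ∣ + k → Minimal (Dense k G) C
    critical⇒circuit {C} crit ∣C∣≡ = (ne , ∣C∣≡) , min
      where
      ne : Nonempty C
      ne = 0<∣p∣⇒Nonempty (subst (0 <_) (sym ∣C∣≡) (≤-trans 1≤k (m≤n+m k _)))
      min : ∀ {Y} → Dense k G Y → Y ⊆ C → C ⊆ Y
      min {Y} (_ , ∣Y∣≡) Y⊆C = decidable-stable (C ⊆? Y) λ C⊈Y →
        <-irrefl (trans (cong (_+ ∣ vs C ∣) ∣Y∣≡)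
                 (trans (lemma (∣ vs Y ∣) (∣ vs C ∣) k) (cong (_+ ∣ vs Y ∣) (sym ∣C∣≡))))
          (crit Y Y⊆C C⊈Y)
        where
        lemma : ∀ vy vc k → vy + k + vc ≡ vc + k + vy
        lemma = solve 3 (λ vy vc k → (vy ⊕ k) ⊕ vc ⊜ (vc ⊕ k) ⊕ vy) refl

  -- Each x in C is avoided by a critical D ⊆ C of excess j + 1. Take D avoiding e and D′
  -- avoiding a point of D: if D′ missed e too, D′ ∪ D would be a proper subset of C whose
  -- excess is at least that of C.
  critical-shrink : ∀ {C e} j → Critical C → e ∈ C → ∣ C ∣ ≡ ∣ vs C ∣ + suc (suc j) →
                    ∃[ C′ ] (Critical C′ × e ∈ C′ × ∣ C′ ∣ ≡ ∣ vs C′ ∣ + suc j)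
  critical-shrink {C} {e} j crit e∈C ∣C∣≡ = result (below e∈C)
    where
    Below : Fin m → Set
    Below x = ∃[ D ] (Critical D × D ⊆ C - x × ∣ D ∣ ≡ ∣ vs D ∣ + suc j)
    below : ∀ {x} → x ∈ C → Below x
    below {x} x∈C =
      -- Deleting one edge lowers the excess by at most 1, so `C - x`, and with it `D`, has excess
      -- at least j + 1; being a proper subset of `C`, `D` has excess below j + 2.
      let (D , critD , D⊆ , ≼D) = critical-below (C - x)
          D⊆C : D ⊆ C
          D⊆C = λ y∈ → p─q⊆p C ⁅ x ⁆ (D⊆ y∈)
          D≺C = crit D D⊆C (λ C⊆D → x∉p-x C x (D⊆ (C⊆D x∈C)))
      in D , critD , (λ {y} → D⊆ {y}) , ≤-antisym
           (upper (∣ C ∣) (∣ vs C ∣) (∣ D ∣) (∣ vs D ∣) ∣C∣≡ D≺C)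
           (lower (∣ C ∣) (∣ vs C ∣) (∣ C - x ∣) (∣ vs (C - x) ∣) (∣ D ∣) (∣ vs D ∣)
             ∣C∣≡ (∣p∣≤1+∣p-x∣ 0 G C x) (vs-mono {C - x} {C} (p─q⊆p C ⁅ x ⁆)) ≼D)
      where
      upper : ∀ c vc d vd → c ≡ vc + suc (suc j) → 1 + (d + vc) ≤ c + vd → d ≤ vd + suc j
      upper c vc d vd refl p = linear _ _ p
        (solve 5 (λ o vc d vd j → d ⊕ ((vc ⊕ (o ⊕ (o ⊕ j))) ⊕ vd)
                                ⊜ (vd ⊕ (o ⊕ j)) ⊕ (o ⊕ (d ⊕ vc)))
          refl 1 vc d vd j)
      lower : ∀ c vc c′ vc′ d vd → c ≡ vc + suc (suc j) → c ≤ 1 + c′ → vc′ ≤ vc →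
              c′ + vd ≤ d + vc′ → vd + suc j ≤ d
      lower c vc c′ vc′ d vd refl p q r = linear _ _ (+-mono-≤ (+-mono-≤ p q) r)
        (solve 7 (λ o vc c′ vc′ d vd j →
            (vd ⊕ (o ⊕ j)) ⊕ (((o ⊕ c′) ⊕ vc) ⊕ (d ⊕ vc′))
          ⊜ d ⊕ (((vc ⊕ (o ⊕ (o ⊕ j))) ⊕ vc′) ⊕ (c′ ⊕ vd)))
          refl 1 vc c′ vc′ d vd j)
    result : Below e → _
    result (D , critD , D⊆ , ∣D∣≡) = result′ (below (⊆C (proj₂ ne)))
      where
      ⊆C : D ⊆ C
      ⊆C y∈ = p─q⊆p C ⁅ e ⁆ (D⊆ y∈)
      ne : Nonempty D
      ne = 0<∣p∣⇒Nonempty (subst (0 <_) (sym ∣D∣≡) (≤-trans (s≤s z≤n) (m≤n+m (suc j) _)))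
      x = proj₁ ne
      result′ : Below x → _
      result′ (D′ , critD′ , D′⊆ , ∣D′∣≡) with e ∈? D′
      ... | yes e∈D′ = D′ , critD′ , e∈D′ , ∣D′∣≡
      ... | no e∉D′ = ⊥-elim (n≮0 {0} (clash (∣ C ∣) (∣ vs C ∣) (∣ D′ ∣) (∣ vs D′ ∣) (∣ U ∣) (∣ vs U ∣)
                        ∣C∣≡ ∣D′∣≡ (critical-≺-∪ critD D′ D⊈D′) (crit U U⊆C C⊈U)))
        where
        U = D′ ∪ D
        D⊈D′ : D ⊈ D′
        D⊈D′ D⊆D′ = x∉p-x C x (D′⊆ (D⊆D′ (proj₂ ne)))
        U⊆C : U ⊆ C
        U⊆C y∈ = [ (λ h → p─q⊆p C ⁅ x ⁆ (D′⊆ h)) , ⊆C ]′ (x∈p∪q⁻ D′ D y∈)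
        C⊈U : C ⊈ U
        C⊈U C⊆U = [ e∉D′ , (λ h → x∉p-x C e (D⊆ h)) ]′ (x∈p∪q⁻ D′ D (C⊆U e∈C))
        clash : ∀ c vc d vd u vu → c ≡ vc + suc (suc j) → d ≡ vd + suc j →
                1 + (d + vu) ≤ u + vd → 1 + (u + vc) ≤ c + vu → 1 ≤ 0
        clash c vc d vd u vu refl refl p q = linear 1 0 (+-mono-≤ p q)
          (solve 6 (λ o vc vd u vu j →
              o ⊕ ((u ⊕ vd) ⊕ ((vc ⊕ (o ⊕ (o ⊕ j))) ⊕ vu))
            ⊜ (o ⊕ ((vd ⊕ (o ⊕ j)) ⊕ vu)) ⊕ (o ⊕ (u ⊕ vc)))
            refl 1 vc vd u vu j)

  critical-of-excess : ∀ {k C e} → Critical C → e ∈ C → 1 ≤ k → ∣ vs C ∣ + k ≤ ∣ C ∣ →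
                       ∃[ C′ ] (Critical C′ × e ∈ C′ × ∣ C′ ∣ ≡ ∣ vs C′ ∣ + k)
  critical-of-excess {suc j} {C} crit e∈C _ le =
    let (d , ∣C∣≡) = m≤n⇒∃[o]m+o≡n le
    in descend d crit e∈C (trans (sym ∣C∣≡) (rearrange (∣ vs C ∣) d))
    where
    rearrange : ∀ v d → v + suc j + d ≡ v + suc (d + j)
    rearrange v d = solve 4 (λ o v j d → (v ⊕ (o ⊕ j)) ⊕ d ⊜ v ⊕ (o ⊕ (d ⊕ j))) refl 1 v j d
    descend : ∀ d {C e} → Critical C → e ∈ C → ∣ C ∣ ≡ ∣ vs C ∣ + suc (d + j) →
              ∃[ C′ ] (Critical C′ × e ∈ C′ × ∣ C′ ∣ ≡ ∣ vs C′ ∣ + suc j)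
    descend zero crit e∈C ∣C∣≡ = _ , crit , e∈C , ∣C∣≡
    descend (suc d) crit e∈C ∣C∣≡ =
      let (_ , crit′ , e∈ , ∣C′∣≡) = critical-shrink (d + j) crit e∈C ∣C∣≡
      in descend d crit′ e∈ ∣C′∣≡

-- Growing a vertex set along the edges of a connected subgraph

module Growth {G : Graph n m} where
  open Graph G
  open Excess G

  incidentˡ : ∀ {e u v} → Joins e u v → Incident e u
  incidentˡ (inj₁ eq) = inj₁ (sym (cong proj₁ eq))
  incidentˡ (inj₂ eq) = inj₂ (sym (cong proj₂ eq))

  joins-sym : ∀ {e u v} → Joins e u v → Joins e v u
  joins-sym (inj₁ eq) = inj₂ eq
  joins-sym (inj₂ eq) = inj₁ eq

  incidentʳ : ∀ {e u v} → Joins e u v → Incident e v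
  incidentʳ j = incidentˡ (joins-sym j)

  joins-sources : ∀ {S e u v} → Joins e u v → u ∈ S → v ∈ S → source e ∈ S × target e ∈ S
  joins-sources {S} (inj₁ eq) u∈ v∈ =
    subst (_∈ S) (sym (cong proj₁ eq)) u∈ , subst (_∈ S) (sym (cong proj₂ eq)) v∈
  joins-sources {S} (inj₂ eq) u∈ v∈ =
    subst (_∈ S) (sym (cong proj₁ eq)) v∈ , subst (_∈ S) (sym (cong proj₂ eq)) u∈

  reachable-sym : ∀ {H : Subgraph G} {u v} → Reachable H u v → Reachable H v u
  reachable-sym = reverse λ (e , e∈ , j) → e , e∈ , joins-sym j

  crossing : ∀ {H : Subgraph G} {S u v} → Reachable H u v → u ∉ S → v ∈ S →
             ∃[ e ] ∃[ x ] ∃[ y ] (e ∈ edges H × Joins e x y × x ∉ S × y ∈ S)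
  crossing ε u∉ v∈ = contradiction v∈ u∉
  crossing {H} {S} {u} (_◅_ {j = w} (e , e∈ , j) r) u∉ v∈ with w ∈? S
  ... | yes w∈ = e , u , w , e∈ , j , u∉ , w∈
  ... | no w∉  = crossing {H = H} r w∉ v∈

  leaves? : (H : Subgraph G) (S : Subset n) →
            Decidable (λ e → e ∈ edges H × ¬ (source e ∈ S × target e ∈ S))
  leaves? H S e = (e ∈? edges H) ×-dec ¬? ((source e ∈? S) ×-dec (target e ∈? S))

  beyond : Subgraph G → Subset n → Subset m
  beyond H S = select (leaves? H S)

  ∈beyond⁺ : ∀ {H S e v} → e ∈ edges H → Incident e v → v ∉ S → e ∈ beyond H S
  ∈beyond⁺ {H} {S} e∈ (inj₁ refl) v∉ = ∈-select⁺ (leaves? H S) (e∈ , λ (s∈ , _) → v∉ s∈)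
  ∈beyond⁺ {H} {S} e∈ (inj₂ refl) v∉ = ∈-select⁺ (leaves? H S) (e∈ , λ (_ , t∈) → v∉ t∈)

  ∈beyond⁻ : ∀ {H S e} → e ∈ beyond H S → e ∈ edges H × ¬ (source e ∈ S × target e ∈ S)
  ∈beyond⁻ {H} {S} = ∈-select⁻ (leaves? H S)

  -- S grows by one vertex and one edge at a time; the count is settled at the last step
  -- by the assumption on the sets T missing exactly j vertices.
  grow : ∀ (H : Subgraph G) j b d S → ∣ verts H ─ S ∣ ≡ d + j →
         (∀ {v} → v ∈ verts H → ∃[ s ] (s ∈ S × Reachable H v s)) →
         (∀ T → S ⊆ T → ∣ verts H ─ T ∣ ≡ j → ∣ verts H ─ T ∣ + b ≤ ∣ beyond H T ∣) →
         ∣ verts H ─ S ∣ + b ≤ ∣ beyond H S ∣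
  grow H j b zero S size reach last = last S (λ s∈ → s∈) size
  grow H j b (suc d) S size reach last = step (crossing {H = H} r (x∈p─q⇒x∉q (verts H) S v∈) s∈S)
    where
    missing = 0<∣p∣⇒Nonempty {p = verts H ─ S} (subst (0 <_) (sym size) (s≤s z≤n))
    v∈ = proj₂ missing
    s∈S = proj₁ (proj₂ (reach (p─q⊆p (verts H) S v∈)))
    r = proj₂ (proj₂ (reach (p─q⊆p (verts H) S v∈)))
    step : ∃[ e ] ∃[ x ] ∃[ y ] (e ∈ edges H × Joins e x y × x ∉ S × y ∈ S) → _
    step (e , x , y , e∈ , j∈ , x∉S , y∈S) = begin
      ∣ verts H ─ S ∣ + b         ≡⟨ cong (_+ b) ∣H─S∣≡ ⟩
      suc (∣ verts H ─ S′ ∣ + b)  ≤⟨ s≤s (grow H j b d S′ size′ reach′ last′) ⟩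
      suc ∣ beyond H S′ ∣         ≤⟨ 1+∣p∣≤∣r∣ {p = beyond H S′} beyond⊆ e∈beyond e∉ ⟩
      ∣ beyond H S ∣              ∎
      where
      open ≤-Reasoning
      S′ = S ∪ ⁅ x ⁆
      S⊆S′ : S ⊆ S′
      S⊆S′ = p⊆p∪q ⁅ x ⁆
      x∈S′ : x ∈ S′
      x∈S′ = q⊆p∪q S ⁅ x ⁆ (x∈⁅x⁆ x)
      x∈H = closed H e∈ (incidentˡ j∈)
      ∣H─S∣≡ : ∣ verts H ─ S ∣ ≡ suc ∣ verts H ─ S′ ∣
      ∣H─S∣≡ = ≤-antisym
        (∣p∣≤1+∣q∣ {x = x} {verts H ─ S} λ y∈ y≢x → x∈p∧x∉q⇒x∈p─q (p─q⊆p (verts H) S y∈)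
          λ y∈S′ → [ x∈p─q⇒x∉q (verts H) S y∈ , (λ y∈x → y≢x (x∈⁅y⁆⇒x≡y x y∈x)) ]′ (x∈p∪q⁻ S ⁅ x ⁆ y∈S′))
        (1+∣p∣≤∣r∣ {p = verts H ─ S′}
          (λ y∈ → x∈p∧x∉q⇒x∈p─q (p─q⊆p (verts H) S′ y∈) λ y∈S → x∈p─q⇒x∉q (verts H) S′ y∈ (S⊆S′ y∈S))
          (x∈p∧x∉q⇒x∈p─q x∈H x∉S)
          (λ x∈ → x∈p─q⇒x∉q (verts H) S′ x∈ x∈S′))
      size′ : ∣ verts H ─ S′ ∣ ≡ d + j
      size′ = suc-injective (trans (sym ∣H─S∣≡) size)
      reach′ : ∀ {v} → v ∈ verts H → ∃[ s ] (s ∈ S′ × Reachable H v s)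
      reach′ v∈ = let (s , s∈ , r) = reach v∈ in s , S⊆S′ s∈ , r
      last′ : ∀ T → S′ ⊆ T → ∣ verts H ─ T ∣ ≡ j → ∣ verts H ─ T ∣ + b ≤ ∣ beyond H T ∣
      last′ T S′⊆T = last T (λ s∈ → S′⊆T (S⊆S′ s∈))
      beyond⊆ : beyond H S′ ⊆ beyond H S
      beyond⊆ f∈ = let (f∈H , ¬in) = ∈beyond⁻ {H} f∈
                   in ∈-select⁺ (leaves? H S) (f∈H , λ (s∈ , t∈) → ¬in (S⊆S′ s∈ , S⊆S′ t∈))
      e∈beyond : e ∈ beyond H S
      e∈beyond = ∈beyond⁺ {H} e∈ (incidentˡ j∈) x∉S
      -- Once `x` is added, both ends of `e` are inside, so `e` is charged to `x` alone.
      e∉ : e ∉ beyond H S′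
      e∉ e∈′ = proj₂ (∈beyond⁻ {H} e∈′) (joins-sources j∈ x∈S′ (S⊆S′ y∈S))

  module _ {H : Subgraph G} (conn : Connected H) {S s} (s∈S : s ∈ S) (s∈H : s ∈ verts H) where

    private
      reach : ∀ {v} → v ∈ verts H → ∃[ t ] (t ∈ S × Reachable H v t)
      reach v∈ = s , s∈S , proj₂ conn _ _ v∈ s∈H

    -- Growth is run until no vertex is missing (`j = 0`), with no spare edge claimed (`b = 0`).
    ∣verts─S∣≤∣beyond∣ : ∣ verts H ─ S ∣ ≤ ∣ beyond H S ∣
    ∣verts─S∣≤∣beyond∣ = subst (_≤ ∣ beyond H S ∣) (+-identityʳ _)
      (grow H 0 0 ∣ verts H ─ S ∣ S (sym (+-identityʳ _)) reach
        (λ T _ eq → ≤-trans (≤-reflexive (trans (+-identityʳ _) eq)) z≤n))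

    -- The last vertex to be added is met by an edge from T and, not being a leaf, by
    -- another edge.
    ∣verts─S∣<∣beyond∣ : (∀ v → ¬ Leaf H v) → ∀ {u} → u ∈ verts H → u ∉ S →
                         ∣ verts H ─ S ∣ < ∣ beyond H S ∣
    ∣verts─S∣<∣beyond∣ leafless u∈H u∉S =
      -- `u` guarantees a missing vertex, so growth can be stopped with exactly one left (`j = 1`),
      -- whose second edge is the spare one (`b = 1`).
      let (d , size) = m≤n⇒∃[o]m+o≡n (0<∣_∣ 0 G (x∈p∧x∉q⇒x∈p─q u∈H u∉S))
      in subst (_≤ ∣ beyond H S ∣) (+-comm _ 1)
           (grow H 1 1 d S (trans (sym size) (+-comm 1 d)) reach last)
      where
      last : ∀ T → S ⊆ T → ∣ verts H ─ T ∣ ≡ 1 → ∣ verts H ─ T ∣ + 1 ≤ ∣ beyond H T ∣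
      last T S⊆T one rewrite one = two (crossing {H = H} (proj₂ conn _ _ (p─q⊆p (verts H) T v∈) s∈H)
                                         (x∈p─q⇒x∉q (verts H) T v∈) (S⊆T s∈S))
        where
        v∈ = proj₂ (0<∣p∣⇒Nonempty {p = verts H ─ T} (subst (0 <_) (sym one) (s≤s z≤n)))
        two : ∃[ e ] ∃[ x ] ∃[ y ] (e ∈ edges H × Joins e x y × x ∉ T × y ∈ T) → 2 ≤ ∣ beyond H T ∣
        two (e , x , y , e∈ , j , x∉T , y∈T)
          with any? (λ f → (f ∈? edges H) ×-dec (incident? f x ×-dec ¬? (f ≟ᶠ e)))
        ... | yes (f , f∈ , i , f≢e) =
          ≤-trans (s≤s (0<∣_∣ 0 G (x∈p∧x≢y⇒x∈p-y (∈beyond⁺ {H} f∈ i x∉T) f≢e)))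
                  (x∈p⇒∣p-x∣<∣p∣ (∈beyond⁺ {H} e∈ (incidentˡ j) x∉T))
        ... | no none = contradiction leaf (leafless x)
          where
          leaf : Leaf H x
          leaf = closed H e∈ (incidentˡ j) , e , (e∈ , incidentˡ j , ¬loop j) ,
                 λ f f∈ i → decidable-stable (f ≟ᶠ e) λ f≢e → none (f , f∈ , i , f≢e)
            where
            ¬loop : Joins e x y → ¬ Loop e
            ¬loop (inj₁ eq) l = x∉T (subst (_∈ T) (trans (sym (cong proj₂ eq)) (trans (sym l) (cong proj₁ eq))) y∈T)
            ¬loop (inj₂ eq) l = x∉T (subst (_∈ T) (trans (sym (cong proj₁ eq)) (trans l (cong proj₂ eq))) y∈T)

    -- An edge of `Y` has both ends in `vs Y`, so the edges charged during growth from `vs Y` are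
    -- all outside `Y`.
    ∣verts─vs∣≤∣edges─∣ : ∀ {Y} → S ≡ vs Y → ∣ beyond H S ∣ ≤ ∣ edges H ─ Y ∣
    ∣verts─vs∣≤∣edges─∣ {Y} refl = p⊆q⇒∣p∣≤∣q∣ λ e∈ →
      let (e∈H , ¬in) = ∈beyond⁻ {H} e∈
      in x∈p∧x∉q⇒x∈p─q e∈H λ e∈Y → ¬in (∈vs⁺ e∈Y (inj₁ refl) , ∈vs⁺ e∈Y (inj₂ refl))

-- Degrees and cycles

𝟙 : Bool → ℕ
𝟙 true  = 1
𝟙 false = 0

∣tabulate∣ : (f : Fin n → Bool) → ∣ tabulate f ∣ ≡ sum (𝟙 ∘ f)
∣tabulate∣ {zero} f = refl
∣tabulate∣ {suc n} f with f zero
... | true  = cong suc (∣tabulate∣ (f ∘ suc))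
... | false = ∣tabulate∣ (f ∘ suc)

∣select∈∣ : (p : Subset n) → ∣ select (_∈? p) ∣ ≡ ∣ p ∣
∣select∈∣ p = cong ∣_∣ (⊆-antisym (∈-select⁻ (_∈? p)) (∈-select⁺ (_∈? p)))

sum-mono : ∀ {f g : Fin n → ℕ} → (∀ i → f i ≤ g i) → sum f ≤ sum g
sum-mono {zero} f≤g = z≤n
sum-mono {suc n} f≤g = +-mono-≤ (f≤g zero) (sum-mono (f≤g ∘ suc))

-- The differences between `g` and `f` are nonnegative and add up to at most 0.
sum-tight : ∀ {f g : Fin n → ℕ} → (∀ i → f i ≤ g i) → sum g ≤ sum f → ∀ i → g i ≤ f i
sum-tight {f = f} {g} f≤g le zero = linear _ _ (+-mono-≤ le (sum-mono (f≤g ∘ suc)))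
  (solve 4 (λ a b c d → c ⊕ ((a ⊕ b) ⊕ d) ⊜ a ⊕ ((c ⊕ d) ⊕ b)) refl
    (f zero) (sum (f ∘ suc)) (g zero) (sum (g ∘ suc)))
sum-tight {f = f} {g} f≤g le (suc i) = sum-tight (f≤g ∘ suc) (linear _ _ (+-mono-≤ le (f≤g zero))
  (solve 4 (λ a b c d → d ⊕ ((a ⊕ b) ⊕ c) ⊜ b ⊕ ((c ⊕ d) ⊕ a)) refl
    (f zero) (sum (f ∘ suc)) (g zero) (sum (g ∘ suc)))) i

x+x-injective : ∀ {x y} → x + x ≡ y + y → x ≡ y
x+x-injective {x} {y} eq = *-cancelˡ-≡ x y 2
  (trans (cong (x +_) (+-identityʳ x)) (trans eq (cong (y +_) (sym (+-identityʳ y)))))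

module Degree {G : Graph n m} where
  open Graph G
  open Excess G
  open Growth {G = G}

  private
    at? : (X : Subset m) (g : Fin m → Fin n) → ∀ v → Decidable (λ e → e ∈ X × v ≡ g e)
    at? X g v e = (e ∈? X) ×-dec (v ≟ᶠ g e)

  -- Double counting of the pairs (v, e) with e in `X` and v = `g e`; each edge of `X` lies in
  -- exactly one fibre.
  sum-fibres : (X : Subset m) (g : Fin m → Fin n) → sum (λ v → ∣ select (at? X g v) ∣) ≡ ∣ X ∣
  sum-fibres X g = begin
    sum (λ v → ∣ select (at? X g v) ∣)                  ≡⟨ sum-cong-≗ (λ v → ∣tabulate∣ (does ∘ at? X g v)) ⟩
    sum (λ v → sum (λ e → 𝟙 (does (at? X g v e))))      ≡⟨ ∑-comm (λ v e → 𝟙 (does (at? X g v e))) ⟩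
    sum (λ e → sum (λ v → 𝟙 (does (at? X g v e))))      ≡⟨ sum-cong-≗ (λ e → sym (∣tabulate∣ λ v → does (at? X g v e))) ⟩
    sum (λ e → ∣ select (λ v → at? X g v e) ∣)          ≡⟨ sum-cong-≗ fibre ⟩
    sum (λ e → 𝟙 (does (e ∈? X)))                       ≡⟨ ∣tabulate∣ (λ e → does (e ∈? X)) ⟨
    ∣ select (_∈? X) ∣                                  ≡⟨ ∣select∈∣ X ⟩
    ∣ X ∣                                               ∎
    where
    open ≡-Reasoning
    fibre : ∀ e → ∣ select (λ v → at? X g v e) ∣ ≡ 𝟙 (does (e ∈? X))
    fibre e with e ∈? X | ∈-select⁺ (λ v → at? X g v e) | ∈-select⁻ (λ v → at? X g v e)
    ... | yes e∈ | ∈⁺ | ∈⁻ = trans (cong ∣_∣ (⊆-antisym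
            (λ {v} v∈ → subst (_∈ ⁅ g e ⁆) (sym (proj₂ (∈⁻ v∈))) (x∈⁅x⁆ (g e)))
            (λ v∈ → ∈⁺ (e∈ , x∈⁅y⁆⇒x≡y (g e) v∈)))) (∣⁅x⁆∣≡1 (g e))
    ... | no e∉  | ∈⁺ | ∈⁻ = Empty⇒∣p∣≡0 λ (v , v∈) → e∉ (proj₁ (∈⁻ v∈))

  handshake : ∀ (H : Subgraph G) → sum (degree H) ≡ ∣ edges H ∣ + ∣ edges H ∣
  handshake H = trans (∑-distrib-+ (λ v → ∣ select (at? (edges H) source v) ∣) _)
                      (cong₂ _+_ (sum-fibres (edges H) source) (sum-fibres (edges H) target))

  -- The degree function of a cycle with vertex set `P`, extended by 0 to all vertices so that it
  -- can be summed against `degree`.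
  twice : Subset n → Fin n → ℕ
  twice P v = 𝟙 (does (v ∈? P)) + 𝟙 (does (v ∈? P))

  sum-twice : ∀ P → sum (twice P) ≡ ∣ P ∣ + ∣ P ∣
  sum-twice P = trans (∑-distrib-+ (λ v → 𝟙 (does (v ∈? P))) _) (cong₂ _+_ eq eq)
    where
    eq : sum (λ v → 𝟙 (does (v ∈? P))) ≡ ∣ P ∣
    eq = trans (sym (∣tabulate∣ λ v → does (v ∈? P))) (∣select∈∣ P)

  degree-outside : ∀ (H : Subgraph G) {v} → v ∉ verts H → degree H v ≡ 0
  degree-outside H {v} v∉ = cong₂ _+_
    (Empty⇒∣p∣≡0 λ (e , e∈) → let (e∈H , eq) = ∈-select⁻ (at? (edges H) source v) e∈ in v∉ (closed H e∈H (inj₁ eq)))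
    (Empty⇒∣p∣≡0 λ (e , e∈) → let (e∈H , eq) = ∈-select⁻ (at? (edges H) target v) e∈ in v∉ (closed H e∈H (inj₂ eq)))

  cycle⇒∣C∣≡ : ∀ {C} → Cycle (G ⟨ C ⟩) → ∣ C ∣ ≡ ∣ vs C ∣
  cycle⇒∣C∣≡ {C} (_ , deg≡2) =
    x+x-injective (trans (sym (handshake (G ⟨ C ⟩))) (trans (sum-cong-≗ pointwise) (sum-twice (vs C))))
    where
    pointwise : ∀ v → degree (G ⟨ C ⟩) v ≡ twice (vs C) v
    pointwise v with v ∈? vs C
    ... | yes v∈ = deg≡2 v v∈
    ... | no v∉  = degree-outside (G ⟨ C ⟩) v∉

  two-edges⇒2≤degree : ∀ (H : Subgraph G) {e f v} → e ∈ edges H → Incident e v → f ∈ edges H → Incident f v → f ≢ e →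
                       2 ≤ degree H v
  two-edges⇒2≤degree H {e} {f} {v} e∈ i f∈ j f≢e = go i j
    where
    two : ∀ {X : Subset m} → e ∈ X → f ∈ X → 2 ≤ ∣ X ∣
    two e∈ f∈ = ≤-trans (s≤s (0<∣_∣ 0 G (x∈p∧x≢y⇒x∈p-y f∈ f≢e))) (x∈p⇒∣p-x∣<∣p∣ e∈)
    S⁺ : ∀ {e} → e ∈ edges H → v ≡ source e → e ∈ select (at? (edges H) source v)
    S⁺ e∈ eq = ∈-select⁺ (at? (edges H) source v) (e∈ , eq)
    T⁺ : ∀ {e} → e ∈ edges H → v ≡ target e → e ∈ select (at? (edges H) target v)
    T⁺ e∈ eq = ∈-select⁺ (at? (edges H) target v) (e∈ , eq)
    go : Incident e v → Incident f v → 2 ≤ degree H v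
    go (inj₁ p) (inj₁ q) = ≤-trans (two (S⁺ e∈ p) (S⁺ f∈ q)) (m≤m+n _ _)
    go (inj₁ p) (inj₂ q) = +-mono-≤ (0<∣_∣ 0 G (S⁺ e∈ p)) (0<∣_∣ 0 G (T⁺ f∈ q))
    go (inj₂ p) (inj₁ q) = +-mono-≤ (0<∣_∣ 0 G (S⁺ f∈ q)) (0<∣_∣ 0 G (T⁺ e∈ p))
    go (inj₂ p) (inj₂ q) = ≤-trans (two (T⁺ e∈ p) (T⁺ f∈ q)) (m≤n+m _ _)

  loop⇒2≤degree : ∀ (H : Subgraph G) {e v} → e ∈ edges H → v ≡ source e → v ≡ target e → 2 ≤ degree H v
  loop⇒2≤degree H {e} {v} e∈ p q =
    +-mono-≤ (0<∣_∣ 0 G (∈-select⁺ (at? (edges H) source v) (e∈ , p)))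
             (0<∣_∣ 0 G (∈-select⁺ (at? (edges H) target v) (e∈ , q)))

  inE? : ∀ (H : Subgraph G) v → Decidable (λ e → e ∈ edges H × Reachable H v (source e))
  inE? H v e = (e ∈? edges H) ×-dec reachable? H v (source e)

  inV? : ∀ (H : Subgraph G) v → Decidable (λ u → u ∈ verts H × Reachable H v u)
  inV? H v u = (u ∈? verts H) ×-dec reachable? H v u

  reachable-end : ∀ {H : Subgraph G} {u e v} → e ∈ edges H → Reachable H u (source e) → Incident e v →
                  Reachable H u v
  reachable-end e∈ r (inj₁ refl) = r
  reachable-end e∈ r (inj₂ refl) = r ◅◅ (_ , e∈ , inj₁ refl) ◅ ε

  reachable-source : ∀ {H : Subgraph G} {u e v} → e ∈ edges H → Incident e v → Reachable H u v →
                     Reachable H u (source e)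
  reachable-source e∈ (inj₁ refl) r = r
  reachable-source e∈ (inj₂ refl) r = r ◅◅ (_ , e∈ , inj₂ refl) ◅ ε

  -- A minimal C with ∣ C ∣ = ∣ vs C ∣ is a cycle: deleting the edge at a vertex of degree one,
  -- or a component, would leave a smaller nonempty set with at least as many edges as vertices.
  module _ {C} (min : Minimal (Dense 0 G) C) where
    private
      ∣C∣≡ : ∣ C ∣ ≡ ∣ vs C ∣
      ∣C∣≡ = trans (proj₂ (proj₁ min)) (+-identityʳ _)

      few : ∀ {X} → X ⊆ C → Nonempty X → C ⊈ X → suc ∣ X ∣ ≤ ∣ vs X ∣
      few X⊆C ne C⊈X = ≤-trans (sparse 0 G min X⊆C ne C⊈X) (≤-reflexive (+-identityʳ _))

      2≤degree : ∀ v → v ∈ vs C → 2 ≤ degree (G ⟨ C ⟩) v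
      2≤degree v v∈ = go (∈vs⁻ C v∈)
        where
        go : ∃[ e ] (e ∈ C × Incident e v) → 2 ≤ degree (G ⟨ C ⟩) v
        go (e , e∈ , i) with any? (λ f → (f ∈? C) ×-dec (incident? f v ×-dec ¬? (f ≟ᶠ e)))
        ... | yes (f , f∈ , j , f≢e) = two-edges⇒2≤degree (G ⟨ C ⟩) e∈ i f∈ j f≢e
        ... | no none with source e ≟ᶠ target e
        ...   | yes loop = loop⇒2≤degree (G ⟨ C ⟩) e∈ (v≡s i) (trans (v≡s i) loop)
          where
          v≡s : Incident e v → v ≡ source e
          v≡s (inj₁ eq) = eq
          v≡s (inj₂ eq) = trans eq (sym loop)
        ...   | no ¬loop = ⊥-elim (absurd (nonempty? (C - e)))
          where
          ∣C∣≤ = ∣p∣≤1+∣p-x∣ 0 G C e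
          v∉ : v ∉ vs (C - e)
          v∉ v∈′ = let (f , f∈ , j) = ∈vs⁻ (C - e) v∈′
                   in none (f , p─q⊆p C ⁅ e ⁆ f∈ , j , λ eq → x∉p-x C e (subst (_∈ C - e) eq f∈))
          absurd : Dec (Nonempty (C - e)) → _
          absurd (yes ne) = <-irrefl ∣C∣≡ (≤-trans (s≤s (≤-trans ∣C∣≤
            (few {C - e} (p─q⊆p C ⁅ e ⁆) ne (λ C⊆ → x∉p-x C e (C⊆ e∈)))))
            (1+∣p∣≤∣r∣ {p = vs (C - e)} (V-mono 0 G {C - e} {C} (p─q⊆p C ⁅ e ⁆)) v∈ v∉))
          -- Here `C` consists of the non-loop `e` alone: two vertices but one edge.
          absurd (no empty) = <-irrefl refl (≤-trans (≤-trans
            (s≤s (0<∣_∣ 0 G (x∈p∧x≢y⇒x∈p-y (∈vs⁺ {C} e∈ (inj₂ refl)) (¬loop ∘ sym))))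
            (x∈p⇒∣p-x∣<∣p∣ (∈vs⁺ {C} e∈ (inj₁ refl))))
            (subst₂ (λ a b → a ≤ suc b) ∣C∣≡ (Empty⇒∣p∣≡0 empty) ∣C∣≤))

      connected : ∀ u v → u ∈ vs C → v ∈ vs C → Reachable (G ⟨ C ⟩) u v
      connected u v u∈ v∈ with C ⊆? edges (component (G ⟨ C ⟩) u)
      ... | yes C⊆ = let (e , e∈ , i) = ∈vs⁻ C v∈
                     in reachable-end {G ⟨ C ⟩} e∈ (proj₂ (∈-select⁻ (inE? (G ⟨ C ⟩) u) (C⊆ e∈))) i
      ... | no C⊈ = ⊥-elim (<-irrefl refl (begin-strict
          ∣ C ∣                        ≤⟨ ∣p∣≤∣q∣+∣p─q∣ C C₁ ⟩
          ∣ C₁ ∣ + ∣ C₂ ∣              <⟨ +-mono-<-≤ (few {C₁} C₁⊆C ne₁ C⊈) (<⇒≤ (few {C₂} (p─q⊆p C C₁) ne₂ C⊈C₂)) ⟩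
          ∣ vs C₁ ∣ + ∣ vs C₂ ∣        ≤⟨ ∣pack∣ (vs C) (vs C₁) (vs C₂) (V-mono 0 G {C₁} {C} C₁⊆C)
                                            (V-mono 0 G {C₂} {C} (p─q⊆p C C₁)) disjoint ⟩
          ∣ vs C ∣                     ≡⟨ ∣C∣≡ ⟨
          ∣ C ∣                        ∎))
        where
        open ≤-Reasoning
        H = G ⟨ C ⟩
        C₁ = edges (component H u)
        C₂ = C ─ C₁
        C₁⊆C : C₁ ⊆ C
        C₁⊆C e∈ = proj₁ (∈-select⁻ (inE? H u) e∈)
        ne₁ : Nonempty C₁
        ne₁ = let (e , e∈ , i) = ∈vs⁻ C u∈ in e , ∈-select⁺ (inE? H u) (e∈ , reachable-source {H} e∈ i ε)
        ne₂ : Nonempty C₂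
        ne₂ = let (e , e∈ , e∉) = ⊈⇒∃ C⊈ in e , x∈p∧x∉q⇒x∈p─q e∈ e∉
        C⊈C₂ : C ⊈ C₂
        C⊈C₂ C⊆ = x∈p─q⇒x∉q C C₁ (C⊆ (C₁⊆C (proj₂ ne₁))) (proj₂ ne₁)
        disjoint : ∀ {w} → w ∈ vs C₁ → w ∉ vs C₂
        disjoint w∈₁ w∈₂ =
          let (e , e∈₁ , i) = ∈vs⁻ C₁ w∈₁
              (f , f∈₂ , j) = ∈vs⁻ C₂ w∈₂
              (e∈ , r) = ∈-select⁻ (inE? H u) e∈₁
              f∈ = p─q⊆p C C₁ f∈₂
          in x∈p─q⇒x∉q C C₁ f∈₂ (∈-select⁺ (inE? H u)
               (f∈ , reachable-source {H} f∈ j (reachable-end {H} e∈ r i)))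

    -- The degrees add up to twice the number of edges, which equals twice the number of vertices;
    -- as each is at least 2, none can be larger.
    minimal⇒cycle : Cycle (G ⟨ C ⟩)
    minimal⇒cycle = ((_ , ∈vs⁺ {C} (proj₂ (proj₁ (proj₁ min))) (inj₁ refl)) , connected) , degree≡2
      where
      twice≤degree : ∀ v → twice (vs C) v ≤ degree (G ⟨ C ⟩) v
      twice≤degree v with v ∈? vs C
      ... | yes v∈ = 2≤degree v v∈
      ... | no v∉  = z≤n
      total : sum (degree (G ⟨ C ⟩)) ≡ sum (twice (vs C))
      total = trans (handshake (G ⟨ C ⟩)) (trans (cong₂ _+_ ∣C∣≡ ∣C∣≡) (sym (sum-twice (vs C))))
      degree≡2 : ∀ v → v ∈ vs C → degree (G ⟨ C ⟩) v ≡ 2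
      degree≡2 v v∈ = ≤-antisym
        (≤-trans (sum-tight twice≤degree (≤-reflexive total) v) twice≤2) (2≤degree v v∈)
        where
        twice≤2 : twice (vs C) v ≤ 2
        twice≤2 with v ∈? vs C
        ... | yes _ = ≤-refl
        ... | no _  = z≤n

-- Trees and components

module _ {P : Pred Elem 0ℓ} {R Q : Elem → Elem → Set} where

  -- Serves to turn the distinctness of deduplicated components into disjointness, which needs to
  -- know that the entries are components.
  refine : (∀ {x y} → P x → P y → R x y → Q x y) → All P xs → AllPairs R xs → AllPairs Q xs
  refine f [] [] = []
  refine f (px ∷ pxs) (rx ∷ rxs) = All.zipWith (λ (py , r) → f px py r) (pxs , rx) ∷ refine f pxs rxs

module _ (g : Elem → Subset n) where

  sum-partition : ∀ {xs} P → AllPairs (λ x y → ∀ {i} → i ∈ g x → i ∉ g y) xs →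
                  (∀ {i} → i ∈ P → Any (λ x → i ∈ g x) xs) → All (λ x → g x ⊆ P) xs →
                  ListAction.sum (List.map (∣_∣ ∘ g) xs) ≡ ∣ P ∣
  sum-partition P [] cover _ = sym (Empty⇒∣p∣≡0 λ (i , i∈) → case-[] (cover i∈))
    where
    case-[] : ∀ {i} → ¬ Any (λ x → i ∈ g x) []
    case-[] ()
  sum-partition {x ∷ xs} P (apart ∷ pairs) cover (gx⊆P ∷ g⊆P) = trans
    (cong (∣ g x ∣ +_) (sum-partition (P ─ g x) pairs cover′ (All.zipWith within (apart , g⊆P))))
    (≤-antisym (∣q∣+∣p─q∣≤∣p∣ P (g x) gx⊆P) (∣p∣≤∣q∣+∣p─q∣ P (g x)))
    where
    cover′ : ∀ {i} → i ∈ P ─ g x → Any (λ y → i ∈ g y) xs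
    cover′ i∈ with cover (p─q⊆p P (g x) i∈)
    ... | here i∈x  = contradiction i∈x (x∈p─q⇒x∉q P (g x) i∈)
    ... | there any = any
    within : ∀ {y} → (∀ {i} → i ∈ g x → i ∉ g y) × g y ⊆ P → g y ⊆ P ─ g x
    within (disjoint , gy⊆P) i∈y = x∈p∧x∉q⇒x∈p─q (gy⊆P i∈y) λ i∈x → disjoint i∈x i∈y

module _ {Q : Pred Elem 0ℓ} (Q? : Decidable Q) (a b : Elem → ℕ) where

  private
    total : (Elem → ℕ) → List Elem → ℕ
    total f xs = ListAction.sum (List.map f xs)
    count : List Elem → ℕ
    count xs = List.length (List.filter Q? xs)

  -- With `Tree` for `Q`, estimates for single components that are off by one exactly on the trees
  -- add up to an estimate that is off by `t`.
  sum-map-≤ : All (λ x → (Q x → a x ≤ suc (b x)) × (¬ Q x → a x ≤ b x)) xs → total a xs ≤ count xs + total b xs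
  sum-map-≤ [] = z≤n
  sum-map-≤ {x ∷ xs} ((yes≤ , no≤) ∷ rest) with Q? x
  ... | yes q = linear _ _ (+-mono-≤ (yes≤ q) (sum-map-≤ rest))
    (solve 6 (λ o a b A B c → (a ⊕ A) ⊕ ((o ⊕ b) ⊕ (c ⊕ B)) ⊜ ((o ⊕ c) ⊕ (b ⊕ B)) ⊕ (a ⊕ A))
      refl 1 (a x) (b x) (total a xs) (total b xs) (count xs))
  ... | no ¬q = linear _ _ (+-mono-≤ (no≤ ¬q) (sum-map-≤ rest))
    (solve 5 (λ a b A B c → (a ⊕ A) ⊕ (b ⊕ (c ⊕ B)) ⊜ (c ⊕ (b ⊕ B)) ⊕ (a ⊕ A))
      refl (a x) (b x) (total a xs) (total b xs) (count xs))

  sum-map-≥ : All (λ x → (Q x → suc (b x) ≤ a x) × (¬ Q x → b x ≤ a x)) xs → count xs + total b xs ≤ total a xs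
  sum-map-≥ [] = z≤n
  sum-map-≥ {x ∷ xs} ((yes≤ , no≤) ∷ rest) with Q? x
  ... | yes q = linear _ _ (+-mono-≤ (yes≤ q) (sum-map-≥ rest))
    (solve 6 (λ o a b A B c → ((o ⊕ c) ⊕ (b ⊕ B)) ⊕ (a ⊕ A) ⊜ (a ⊕ A) ⊕ ((o ⊕ b) ⊕ (c ⊕ B)))
      refl 1 (a x) (b x) (total a xs) (total b xs) (count xs))
  ... | no ¬q = linear _ _ (+-mono-≤ (no≤ ¬q) (sum-map-≥ rest))
    (solve 5 (λ a b A B c → (c ⊕ (b ⊕ B)) ⊕ (a ⊕ A) ⊜ (a ⊕ A) ⊕ (b ⊕ (c ⊕ B)))
      refl (a x) (b x) (total a xs) (total b xs) (count xs))

module Trees {G : Graph n m} where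
  open Graph G
  open Excess G
  open Growth {G = G}
  open Degree {G = G}

  vs⊆verts : ∀ {H : Subgraph G} {X} → X ⊆ edges H → vs X ⊆ verts H
  vs⊆verts {H} {X} X⊆ v∈ = let (e , e∈ , i) = ∈vs⁻ X v∈ in closed H (X⊆ e∈) i

  connected⇒∣verts∣≤ : ∀ {H : Subgraph G} → Connected H → ∣ verts H ∣ ≤ suc ∣ edges H ∣
  connected⇒∣verts∣≤ {H} conn@((v , v∈) , _) = begin
    ∣ verts H ∣                      ≤⟨ ∣p∣≤∣q∣+∣p─q∣ (verts H) ⁅ v ⁆ ⟩
    ∣ ⁅ v ⁆ ∣ + ∣ verts H ─ ⁅ v ⁆ ∣  ≡⟨ cong (_+ ∣ verts H ─ ⁅ v ⁆ ∣) (∣⁅x⁆∣≡1 v) ⟩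
    suc ∣ verts H ─ ⁅ v ⁆ ∣          ≤⟨ s≤s (∣verts─S∣≤∣beyond∣ {H} conn (x∈⁅x⁆ v) v∈) ⟩
    suc ∣ beyond H ⁅ v ⁆ ∣           ≤⟨ s≤s (p⊆q⇒∣p∣≤∣q∣ λ e∈ → proj₁ (∈beyond⁻ {H} e∈)) ⟩
    suc ∣ edges H ∣                  ∎
    where open ≤-Reasoning

  ∣verts─vs∣≤ : ∀ {H : Subgraph G} → Connected H → ∀ Y {v} → v ∈ verts H → v ∈ vs Y →
                ∣ verts H ─ vs Y ∣ ≤ ∣ edges H ─ Y ∣
  ∣verts─vs∣≤ {H} conn Y v∈H v∈Y =
    ≤-trans (∣verts─S∣≤∣beyond∣ {H} conn v∈Y v∈H) (∣verts─vs∣≤∣edges─∣ {H} conn v∈Y v∈H refl)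

  -- Growth starts from the cycle, where vertices and edges balance, and uses a new edge for each
  -- further vertex.
  hasCycle⇒∣verts∣≤∣edges∣ : ∀ {H : Subgraph G} → Connected H → HasCycle H → ∣ verts H ∣ ≤ ∣ edges H ∣
  hasCycle⇒∣verts∣≤∣edges∣ {H} conn (C , C⊆ , cycle@(((v , v∈) , _) , _)) = begin
    ∣ verts H ∣                      ≤⟨ ∣p∣≤∣q∣+∣p─q∣ (verts H) (vs C) ⟩
    ∣ vs C ∣ + ∣ verts H ─ vs C ∣    ≡⟨ cong (_+ ∣ verts H ─ vs C ∣) (cycle⇒∣C∣≡ cycle) ⟨
    ∣ C ∣ + ∣ verts H ─ vs C ∣       ≤⟨ +-monoʳ-≤ ∣ C ∣ (∣verts─vs∣≤ {H} conn C (vs⊆verts {H} {C} C⊆ v∈) v∈) ⟩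
    ∣ C ∣ + ∣ edges H ─ C ∣          ≤⟨ ∣q∣+∣p─q∣≤∣p∣ (edges H) C C⊆ ⟩
    ∣ edges H ∣                      ∎
    where open ≤-Reasoning

  -- The case k = 0 of density: an inclusion-minimal set with as many edges as vertices is a cycle.
  ∣verts∣≤∣edges∣⇒hasCycle : ∀ {H : Subgraph G} → Connected H → ∣ verts H ∣ ≤ ∣ edges H ∣ → HasCycle H
  ∣verts∣≤∣edges∣⇒hasCycle {H} ((v , v∈) , _) le =
    let (D , dense , D⊆) = dense-below 0 G (edges H) (0<∣p∣⇒Nonempty (≤-trans (0<∣_∣ 0 G v∈) le))
          (≤-trans (≤-reflexive (+-identityʳ _)) (≤-trans (p⊆q⇒∣p∣≤∣q∣ (vs⊆verts {H} {edges H} λ e∈ → e∈)) le))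
        (C , min , C⊆) = minimal-below (dense? 0 G) dense
    in C , (λ e∈ → D⊆ (C⊆ e∈)) , minimal⇒cycle min

  tree⇒∣edges∣<∣verts∣ : ∀ {H : Subgraph G} → Tree H → ∣ edges H ∣ < ∣ verts H ∣
  tree⇒∣edges∣<∣verts∣ {H} (conn , acyclic) = ≰⇒> λ le → acyclic (∣verts∣≤∣edges∣⇒hasCycle {H} conn le)

  ¬tree⇒∣verts∣≤∣edges∣ : ∀ {H : Subgraph G} → Connected H → ¬ Tree H → ∣ verts H ∣ ≤ ∣ edges H ∣
  ¬tree⇒∣verts∣≤∣edges∣ {H} conn ¬tree = ≮⇒≥ λ lt →
    ¬tree (conn , λ cyc → <⇒≱ lt (hasCycle⇒∣verts∣≤∣edges∣ {H} conn cyc))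

  -- Decomposition into components and the extremal formula for t

  module Component (H : Subgraph G) where

    lift : ∀ {v u w} → Reachable H v u → Reachable H u w → Reachable (component H v) u w
    lift r ε = ε
    lift r ((e , e∈ , j) ◅ s) =
      (e , ∈-select⁺ (inE? H _) (e∈ , reachable-source {H} e∈ (incidentˡ j) r) , j) ◅
      lift (r ◅◅ (e , e∈ , j) ◅ ε) s

    component-connected : ∀ {v} → v ∈ verts H → Connected (component H v)
    component-connected {v} v∈ = (v , ∈-select⁺ (inV? H v) (v∈ , ε)) , λ u w u∈ w∈ →
      let (_ , v⇝u) = ∈-select⁻ (inV? H v) u∈
          (_ , v⇝w) = ∈-select⁻ (inV? H v) w∈
      in lift v⇝u (reachable-sym {H} v⇝u ◅◅ v⇝w)

    component-verts⊆ : ∀ {v w} → Reachable H w v → verts (component H v) ⊆ verts (component H w)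
    component-verts⊆ {v} {w} r u∈ = let (u∈H , s) = ∈-select⁻ (inV? H v) u∈
                                    in ∈-select⁺ (inV? H w) (u∈H , r ◅◅ s)

    component-edges⊆ : ∀ {v w} → Reachable H w v → edges (component H v) ⊆ edges (component H w)
    component-edges⊆ {v} {w} r u∈ = let (u∈H , s) = ∈-select⁻ (inE? H v) u∈
                                    in ∈-select⁺ (inE? H w) (u∈H , r ◅◅ s)

    component-verts≡ : ∀ {v w} → Reachable H v w → verts (component H v) ≡ verts (component H w)
    component-verts≡ r = ⊆-antisym (component-verts⊆ (reachable-sym {H} r)) (component-verts⊆ r)

    component-edges≡ : ∀ {v w} → Reachable H v w → edges (component H v) ≡ edges (component H w)
    component-edges≡ r = ⊆-antisym (component-edges⊆ (reachable-sym {H} r)) (component-edges⊆ r)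

    IsComponent : Pred (Subgraph G) 0ℓ
    IsComponent A = ∃[ v ] (v ∈ verts H × A ≡ component H v)

    components-are : All IsComponent (components H)
    components-are = All.deduplicate⁺ _ (All.map⁺ (All.map (λ {v} v∈ → v , v∈ , refl)
                       (All.all-filter (_∈? verts H) (List.allFin n))))

    components-cover : ∀ {v} → v ∈ verts H → Any (λ A → v ∈ verts A) (components H)
    components-cover {v} v∈ = Any.deduplicate⁺ _ (λ eq → subst (v ∈_) (sym eq))
      (Any.map⁺ (lose (∈-filter⁺ (_∈? verts H) (∈-allFin v) v∈) (∈-select⁺ (inV? H v) (v∈ , ε))))

    components-cover-edges : ∀ {e} → e ∈ edges H → Any (λ A → e ∈ edges A) (components H)
    components-cover-edges {e} e∈ with find (components-cover (closed H e∈ (inj₁ refl)))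
    ... | A , A∈ , s∈ with All.lookup components-are A∈
    ... | v , _ , refl = lose A∈ (∈-select⁺ (inE? H v) (e∈ , proj₂ (∈-select⁻ (inV? H v) s∈)))

    components-disjoint : AllPairs (λ A B → ∀ {v} → v ∈ verts A → v ∉ verts B) (components H)
    components-disjoint = refine apart components-are
      (Unique.deduplicate-! (On.decSetoid (decSetoid (Vec-≡-dec _≟ᵇ_)) verts) _)
      where
      apart : ∀ {A B} → IsComponent A → IsComponent B → verts A ≢ verts B → ∀ {v} → v ∈ verts A → v ∉ verts B
      apart (u , _ , refl) (w , _ , refl) ≢ v∈A v∈B = ≢ (component-verts≡
        (proj₂ (∈-select⁻ (inV? H u) v∈A) ◅◅ reachable-sym {H} (proj₂ (∈-select⁻ (inV? H w) v∈B))))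

    components-edge-disjoint : AllPairs (λ A B → ∀ {e} → e ∈ edges A → e ∉ edges B) (components H)
    components-edge-disjoint = refine {P = IsComponent} (λ {A} {B} _ _ disjoint e∈A e∈B →
      disjoint (closed A e∈A (inj₁ refl)) (closed B e∈B (inj₁ refl))) components-are components-disjoint

    component-⊆ : ∀ {A} → IsComponent A → verts A ⊆ verts H × edges A ⊆ edges H
    component-⊆ (v , _ , refl) = (λ u∈ → proj₁ (∈-select⁻ (inV? H v) u∈)) , (λ e∈ → proj₁ (∈-select⁻ (inE? H v) e∈))

    private
      restrict : ∀ {l} {p q r : Subset l} → p ⊆ q → p ─ r ⊆ q ─ r
      restrict {p = p} {q} {r} p⊆q x∈ = x∈p∧x∉q⇒x∈p─q (p⊆q (p─q⊆p p r x∈)) (x∈p─q⇒x∉q p r x∈)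

    sum-verts : ∀ S → ListAction.sum (List.map (λ A → ∣ verts A ─ S ∣) (components H)) ≡ ∣ verts H ─ S ∣
    sum-verts S = sum-partition (λ A → verts A ─ S) (verts H ─ S)
      (refine {P = IsComponent}
        (λ {A} {B} _ _ disjoint v∈A v∈B → disjoint (p─q⊆p (verts A) S v∈A) (p─q⊆p (verts B) S v∈B))
        components-are components-disjoint)
      (λ v∈ → let (A , A∈ , v∈A) = find (components-cover (p─q⊆p (verts H) S v∈))
              in lose A∈ (x∈p∧x∉q⇒x∈p─q v∈A (x∈p─q⇒x∉q (verts H) S v∈)))
      (All.map {Q = λ A → verts A ─ S ⊆ verts H ─ S}
        (λ {A} is v∈ → restrict {p = verts A} {verts H} {S} (proj₁ (component-⊆ is)) v∈) components-are)

    sum-edges : ∀ Y → ListAction.sum (List.map (λ A → ∣ edges A ─ Y ∣) (components H)) ≡ ∣ edges H ─ Y ∣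
    sum-edges Y = sum-partition (λ A → edges A ─ Y) (edges H ─ Y)
      (refine {P = IsComponent}
        (λ {A} {B} _ _ disjoint e∈A e∈B → disjoint (p─q⊆p (edges A) Y e∈A) (p─q⊆p (edges B) Y e∈B))
        components-are components-edge-disjoint)
      (λ e∈ → let (A , A∈ , e∈A) = find (components-cover-edges (p─q⊆p (edges H) Y e∈))
              in lose A∈ (x∈p∧x∉q⇒x∈p─q e∈A (x∈p─q⇒x∉q (edges H) Y e∈)))
      (All.map {Q = λ A → edges A ─ Y ⊆ edges H ─ Y}
        (λ {A} is e∈ → restrict {p = edges A} {edges H} {Y} (proj₂ (component-⊆ is)) e∈) components-are)

    -- Componentwise. If `vs Y` meets the component, growth from `vs Y` pays for each vertex with an
    -- edge outside `Y`. Otherwise none of its edges is in `Y`, and only a tree has more vertices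
    -- than edges, by one.
    ∣verts─vs∣≤t+∣edges─∣ : ∀ Y → ∣ verts H ─ vs Y ∣ ≤ t H + ∣ edges H ─ Y ∣
    ∣verts─vs∣≤t+∣edges─∣ Y = subst₂ (λ a b → a ≤ t H + b) (sum-verts (vs Y)) (sum-edges Y)
      (sum-map-≤ tree? (λ A → ∣ verts A ─ vs Y ∣) (λ A → ∣ edges A ─ Y ∣) (All.map bound components-are))
      where
      bound : ∀ {A} → IsComponent A → (Tree A → ∣ verts A ─ vs Y ∣ ≤ suc ∣ edges A ─ Y ∣)
                                    × (¬ Tree A → ∣ verts A ─ vs Y ∣ ≤ ∣ edges A ─ Y ∣)
      bound {A} (v , v∈ , refl) with nonempty? (verts A ∩ vs Y)
      ... | yes (u , u∈) = (λ _ → m≤n⇒m≤1+n le) , (λ _ → le)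
        where
        le : ∣ verts A ─ vs Y ∣ ≤ ∣ edges A ─ Y ∣
        le = let (u∈A , u∈Y) = x∈p∩q⁻ (verts A) (vs Y) u∈
             in ∣verts─vs∣≤ {A} (component-connected v∈) Y u∈A u∈Y
      ... | no apart = (λ _ → ≤-trans ∣A─∣≤ (≤-trans (connected⇒∣verts∣≤ {A} conn) (s≤s ∣E∣≤)))
                     , (λ ¬tree → ≤-trans ∣A─∣≤ (≤-trans (¬tree⇒∣verts∣≤∣edges∣ {A} conn ¬tree) ∣E∣≤))
        where
        conn = component-connected v∈
        ∣A─∣≤ = ∣p─q∣≤∣p∣ (verts A) (vs Y)
        ∣E∣≤ : ∣ edges A ∣ ≤ ∣ edges A ─ Y ∣
        ∣E∣≤ = p⊆q⇒∣p∣≤∣q∣ λ {e} e∈ → x∈p∧x∉q⇒x∈p─q e∈ λ e∈Y →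
          apart (source e , x∈p∩q⁺ (closed A e∈ (inj₁ refl) , ∈vs⁺ {Y} e∈Y (inj₁ refl)))

    -- These are the edges of the components that are not trees. They are singled out by counting
    -- because the counts carry over when a component is described from another base vertex.
    cyclic? : Decidable (λ e → e ∈ edges H × ∣ verts (component H (source e)) ∣ ≤ ∣ edges (component H (source e)) ∣)
    cyclic? e = (e ∈? edges H) ×-dec (∣ verts (component H (source e)) ∣ ≤? ∣ edges (component H (source e)) ∣)

    private
      W = select cyclic?

    -- A tree component is disjoint from `W` and `vs W` and keeps its surplus vertex; any other
    -- component has all its edges in `W`, leaving 0 on the left.
    t+∣edges─∣≤∣verts─vs∣ : t H + ∣ edges H ─ W ∣ ≤ ∣ verts H ─ vs W ∣
    t+∣edges─∣≤∣verts─vs∣ = subst₂ (λ a b → t H + b ≤ a) (sum-verts (vs W)) (sum-edges W)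
      (sum-map-≥ tree? (λ A → ∣ verts A ─ vs W ∣) (λ A → ∣ edges A ─ W ∣) (All.map bound components-are))
      where
      bound : ∀ {A} → IsComponent A → (Tree A → suc ∣ edges A ─ W ∣ ≤ ∣ verts A ─ vs W ∣)
                                    × (¬ Tree A → ∣ edges A ─ W ∣ ≤ ∣ verts A ─ vs W ∣)
      bound {A} (v , v∈ , refl) = tree , ¬tree
        where
        tree : Tree A → suc ∣ edges A ─ W ∣ ≤ ∣ verts A ─ vs W ∣
        tree T = ≤-trans (s≤s (∣p─q∣≤∣p∣ (edges A) W)) (≤-trans (tree⇒∣edges∣<∣verts∣ {A} T)
          (p⊆q⇒∣p∣≤∣q∣ λ u∈ → x∈p∧x∉q⇒x∈p─q u∈ λ u∈W →
            let (e , e∈ , i) = ∈vs⁻ W u∈W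
                (e∈H , le) = ∈-select⁻ cyclic? e∈
                r = reachable-source {H} e∈H i (proj₂ (∈-select⁻ (inV? H v) u∈))
            in <⇒≱ (tree⇒∣edges∣<∣verts∣ {A} T)
                   (subst₂ (λ V E → ∣ V ∣ ≤ ∣ E ∣) (sym (component-verts≡ r)) (sym (component-edges≡ r)) le)))
        ¬tree : ¬ Tree A → ∣ edges A ─ W ∣ ≤ ∣ verts A ─ vs W ∣
        ¬tree ¬T = ≤-trans (≤-reflexive (Empty⇒∣p∣≡0 λ (e , e∈) →
          let (e∈H , r) = ∈-select⁻ (inE? H v) (p─q⊆p (edges A) W e∈)
          in x∈p─q⇒x∉q (edges A) W e∈ (∈-select⁺ cyclic? (e∈H ,
               subst₂ (λ V E → ∣ V ∣ ≤ ∣ E ∣) (component-verts≡ r) (component-edges≡ r)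
                 (¬tree⇒∣verts∣≤∣edges∣ {A} (component-connected v∈) ¬T))))) z≤n

    -- t H is the maximum over Y ⊆ edges H of the excess of Y, less the excess of H
    t-bound : ∀ {Y} → Y ⊆ edges H → ∣ verts H ∣ + ∣ Y ∣ ≤ t H + ∣ edges H ∣ + ∣ vs Y ∣
    t-bound {Y} Y⊆ = lemma (∣ verts H ∣) (∣ Y ∣) (t H) (∣ edges H ∣) (∣ vs Y ∣) _ _
      (∣p∣≤∣q∣+∣p─q∣ (verts H) (vs Y)) (∣q∣+∣p─q∣≤∣p∣ (edges H) Y Y⊆) (∣verts─vs∣≤t+∣edges─∣ Y)
      where
      lemma : ∀ v y t e vy v′ e′ → v ≤ vy + v′ → y + e′ ≤ e → v′ ≤ t + e′ → v + y ≤ t + e + vy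
      lemma v y t e vy v′ e′ p q r = linear _ _ (+-mono-≤ (+-mono-≤ p q) r)
        (solve 7 (λ v y t e vy v′ e′ → (v ⊕ y) ⊕ (((vy ⊕ v′) ⊕ e) ⊕ (t ⊕ e′))
                                     ⊜ ((t ⊕ e) ⊕ vy) ⊕ ((v ⊕ (y ⊕ e′)) ⊕ v′)) refl v y t e vy v′ e′)

    t-attained : ∃[ W ] (W ⊆ edges H × t H + ∣ edges H ∣ + ∣ vs W ∣ ≤ ∣ verts H ∣ + ∣ W ∣)
    t-attained = W , (λ e∈ → W⊆ e∈) , lemma (∣ verts H ∣) (∣ W ∣) (t H) (∣ edges H ∣) (∣ vs W ∣) _ _
      (∣q∣+∣p─q∣≤∣p∣ (verts H) (vs W) (vs⊆verts {H} {W} W⊆)) (∣p∣≤∣q∣+∣p─q∣ (edges H) W) t+∣edges─∣≤∣verts─vs∣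
      where
      W⊆ : W ⊆ edges H
      W⊆ e∈ = proj₁ (∈-select⁻ cyclic? e∈)
      lemma : ∀ v y t e vy v′ e′ → vy + v′ ≤ v → e ≤ y + e′ → t + e′ ≤ v′ → t + e + vy ≤ v + y
      lemma v y t e vy v′ e′ p q r = linear _ _ (+-mono-≤ (+-mono-≤ p q) r)
        (solve 7 (λ v y t e vy v′ e′ → ((t ⊕ e) ⊕ vy) ⊕ ((v ⊕ (y ⊕ e′)) ⊕ v′)
                                     ⊜ (v ⊕ y) ⊕ (((vy ⊕ v′) ⊕ e) ⊕ (t ⊕ e′))) refl v y t e vy v′ e′)

-- The core

1≤⊖⇒> : ∀ {a b} → 1ℤ ℤ.≤ a ⊖ b → b < a
1≤⊖⇒> {a} {b} 1≤ = ≰⇒> λ a≤b → absurd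
  (ℤ.≤-trans 1≤ (ℤ.≤-trans (ℤ.⊖-monoˡ-≤ b a≤b) (ℤ.≤-reflexive (ℤ.n⊖n≡0 b))))
  where
  absurd : ¬ (1ℤ ℤ.≤ ℤ.0ℤ)
  absurd (+≤+ ())

>⇒1≤⊖ : ∀ {a b} → b < a → 1ℤ ℤ.≤ a ⊖ b
>⇒1≤⊖ {a} {b} b<a = ℤ.≤-trans (+≤+ (m<n⇒0<n∸m b<a)) (ℤ.≤-reflexive (sym (ℤ.⊖-≥ (<⇒≤ b<a))))

module Core {G : Graph n m} where
  open Graph G
  open Excess G
  open Growth {G = G}
  open Degree {G = G}
  open Trees {G = G}
  open Component (whole G)

  -- If an edge set Z touches all vertices of H, it misses an edge; otherwise growing vs Z
  -- to verts H costs more edges than vertices.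
  leafless⇒critical : ∀ {H : Subgraph G} → Connected H → (∀ v → ¬ Leaf H v) → ∣ verts H ∣ < ∣ edges H ∣ →
                      Critical (edges H)
  leafless⇒critical {H} conn leafless lt Z Z⊆ E⊈Z = begin-strict
    ∣ Z ∣ + ∣ vs (edges H) ∣  ≤⟨ +-monoʳ-≤ ∣ Z ∣ (p⊆q⇒∣p∣≤∣q∣ (vs⊆verts {H} {edges H} λ e∈ → e∈)) ⟩
    ∣ Z ∣ + ∣ verts H ∣       <⟨ fewer (nonempty? Z) ⟩
    ∣ edges H ∣ + ∣ vs Z ∣    ∎
    where
    open ≤-Reasoning
    fewer : Dec (Nonempty Z) → ∣ Z ∣ + ∣ verts H ∣ < ∣ edges H ∣ + ∣ vs Z ∣
    fewer (no empty) rewrite Empty⇒∣p∣≡0 empty = ≤-trans lt (m≤m+n _ _)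
    fewer (yes (z , z∈)) with verts H ⊆? vs Z
    ... | yes H⊆ = let (e , e∈ , e∉) = ⊈⇒∃ E⊈Z
                   in +-mono-<-≤ (1+∣p∣≤∣r∣ {p = Z} Z⊆ e∈ e∉) (p⊆q⇒∣p∣≤∣q∣ H⊆)
    ... | no H⊈  =
      let (u , u∈ , u∉) = ⊈⇒∃ H⊈
          s∈Z = ∈vs⁺ {Z} z∈ (inj₁ refl)
          s∈H = closed H (Z⊆ z∈) (inj₁ refl)
      in lemma (∣ Z ∣) (∣ verts H ∣) (∣ edges H ∣) (∣ vs Z ∣) _ _
           (∣q∣+∣p─q∣≤∣p∣ (edges H) Z Z⊆) (∣p∣≤∣q∣+∣p─q∣ (verts H) (vs Z))
           (≤-trans (∣verts─S∣<∣beyond∣ {H} conn s∈Z s∈H leafless u∈ u∉)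
                    (∣verts─vs∣≤∣edges─∣ {H} conn s∈Z s∈H refl))
      where
      lemma : ∀ z v e vz e′ v′ → z + e′ ≤ e → v ≤ vz + v′ → 1 + v′ ≤ e′ → 1 + (z + v) ≤ e + vz
      lemma z v e vz e′ v′ p q r = linear _ _ (+-mono-≤ (+-mono-≤ p q) r)
        (solve 7 (λ o z v e vz e′ v′ → (o ⊕ (z ⊕ v)) ⊕ ((e ⊕ (vz ⊕ v′)) ⊕ e′)
                                     ⊜ (e ⊕ vz) ⊕ (((z ⊕ e′) ⊕ v) ⊕ (o ⊕ v′))) refl 1 z v e vz e′ v′)

  kernel-induction : (P : Pred (Subgraph G) 0ℓ) → (∀ {H v} → Leaf H v → P H → P (H ∖ᵥ v)) →
                     ∀ {H} → P H → P (kernel H)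
  kernel-induction P step = go n
    where
    prune-preserves : ∀ {H} → P H → P (prune H)
    prune-preserves {H} p with any? (leaf? H)
    ... | yes (v , leaf) = step leaf p
    ... | no _           = p
    go : ∀ f {H} → P H → P (iterate prune H f)
    go zero    p = p
    go (suc f) p = go f (prune-preserves p)

  keep? : ∀ (H : Subgraph G) v → Decidable (λ e → e ∈ edges H × ¬ Incident e v)
  keep? H v e = (e ∈? edges H) ×-dec ¬? (incident? e v)

  joins-unique : ∀ {e a b c d} → Joins e a b → Joins e c d → (a ≡ c × b ≡ d) ⊎ (a ≡ d × b ≡ c)
  joins-unique (inj₁ p) (inj₁ q) = let eq = trans (sym p) q in inj₁ (cong proj₁ eq , cong proj₂ eq)
  joins-unique (inj₁ p) (inj₂ q) = let eq = trans (sym p) q in inj₂ (cong proj₁ eq , cong proj₂ eq)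
  joins-unique (inj₂ p) (inj₁ q) = let eq = trans (sym p) q in inj₂ (cong proj₂ eq , cong proj₁ eq)
  joins-unique (inj₂ p) (inj₂ q) = let eq = trans (sym p) q in inj₁ (cong proj₂ eq , cong proj₁ eq)

  other-end : ∀ {e v} → Incident e v → ¬ Loop e → ∃[ w ] (Joins e v w × w ≢ v)
  other-end (inj₁ refl) ¬loop = _ , inj₁ refl , (¬loop ∘ sym)
  other-end (inj₂ refl) ¬loop = _ , inj₂ refl , ¬loop

  -- A path avoiding its end v enters v only through the leaf edge, and leaves it at once
  -- along the same edge.
  leaf-connected : ∀ {H : Subgraph G} {v} → Leaf H v → Connected H → Connected (H ∖ᵥ v)
  leaf-connected {H} {v} (v∈ , e , (e∈ , i , ¬loop) , unique) (_ , path) =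
    (w , x∈p∧x≢y⇒x∈p-y (closed H e∈ (incidentʳ j)) w≢v) , λ x y x∈ y∈ →
      proj₁ (avoid (path x y (p─q⊆p (verts H) ⁅ v ⁆ x∈) (p─q⊆p (verts H) ⁅ v ⁆ y∈)) (≢v y∈)) (≢v x∈)
    where
    w = proj₁ (other-end i ¬loop)
    j = proj₁ (proj₂ (other-end i ¬loop))
    w≢v = proj₂ (proj₂ (other-end i ¬loop))
    ≢v : ∀ {x} → x ∈ verts H - v → x ≢ v
    ≢v x∈ refl = x∉p-x (verts H) v x∈
    R = Reachable (H ∖ᵥ v)
    -- The induction on the path also has to cover tails that start at `v`; these are rerouted to
    -- start at its only neighbour `w`.
    avoid : ∀ {x y} → Reachable H x y → y ≢ v → (x ≢ v → R x y) × (x ≡ v → R w y)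
    avoid ε y≢v = (λ _ → ε) , λ x≡v → contradiction x≡v y≢v
    avoid {x} {y} (_◅_ {j = z} (f , f∈ , k) r) y≢v = from≢ , from≡
      where
      rest = avoid r y≢v
      from≢ : x ≢ v → R x y
      from≢ x≢v with incident? f v
      ... | no ¬i  = (f , ∈-select⁺ (keep? H v) (f∈ , ¬i) , k) ◅
                     proj₁ rest λ z≡v → ¬i (subst (Incident f) z≡v (incidentʳ k))
      ... | yes i′ with joins-unique j (subst (λ g → Joins g x z) (unique f f∈ i′) k)
      ...   | inj₁ (v≡x , _)   = contradiction (sym v≡x) x≢v
      ...   | inj₂ (v≡z , w≡x) = subst (λ x → R x y) w≡x (proj₂ rest (sym v≡z))
      from≡ : x ≡ v → R w y
      from≡ x≡v with joins-unique j (subst (λ g → Joins g x z) (unique f f∈ (subst (Incident f) x≡v (incidentˡ k))) k)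
      ... | inj₁ (_ , w≡z) = subst (λ u → R u y) (sym w≡z) (proj₁ rest λ z≡v → w≢v (trans w≡z z≡v))
      ... | inj₂ (_ , w≡x) = contradiction (trans w≡x x≡v) w≢v

  leaf-size : ∀ {H : Subgraph G} {v} → Leaf H v → ∣ verts H ∣ < ∣ edges H ∣ → ∣ verts (H ∖ᵥ v) ∣ < ∣ edges (H ∖ᵥ v) ∣
  leaf-size {H} {v} (v∈ , e , _ , unique) lt = s≤s⁻¹ (≤-trans (s≤s (x∈p⇒∣p-x∣<∣p∣ v∈)) (≤-trans lt
    (∣p∣≤1+∣q∣ {x = e} λ {f} f∈ f≢e → ∈-select⁺ (keep? H v) (f∈ , λ i → f≢e (unique f f∈ i)))))

  kernel-critical : ∀ {H : Subgraph G} → Connected H → ∣ verts H ∣ < ∣ edges H ∣ → Critical (edges (kernel H))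
  kernel-critical {H} conn lt =
    let (conn′ , lt′) = kernel-induction (λ K → Connected K × ∣ verts K ∣ < ∣ edges K ∣)
          (λ {K} leaf (conn , lt) → leaf-connected {K} leaf conn , leaf-size {K} leaf lt) {H} (conn , lt)
    in leafless⇒critical {kernel H} conn′ (λ v leaf → kernel-leafless H (v , leaf)) lt′

  ∈-union⁺ : ∀ {e} {Hs : List (Subgraph G)} → Any (λ H → e ∈ edges H) Hs → e ∈ edges (List.foldr _∪ᴳ_ ∅ᴳ Hs)
  ∈-union⁺ (here e∈)   = x∈p∪q⁺ (inj₁ e∈)
  ∈-union⁺ (there any) = x∈p∪q⁺ (inj₂ (∈-union⁺ any))

  ∈-union⁻ : ∀ {e} (Hs : List (Subgraph G)) → e ∈ edges (List.foldr _∪ᴳ_ ∅ᴳ Hs) → Any (λ H → e ∈ edges H) Hs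
  ∈-union⁻ []       e∈ = contradiction e∈ ∉⊥
  ∈-union⁻ (H ∷ Hs) e∈ = [ here , (λ e∈′ → there (∈-union⁻ Hs e∈′)) ]′ (x∈p∪q⁻ (edges H) _ e∈)

  private
    big? : Decidable (λ (A : Subgraph G) → 1ℤ ℤ.≤ Δ A)
    big? A = 1ℤ ℤ.≤? Δ A

  core⇒critical : ∀ {e} → e ∈ edges (core G) → ∃[ C ] (Critical C × e ∈ C)
  core⇒critical e∈ with find (Any.map⁻ (∈-union⁻ (List.map kernel (List.filter big? (components (whole G)))) e∈))
  ... | A , A∈ , e∈A with ∈-filter⁻ big? {xs = components (whole G)} A∈
  ... | A∈′ , 1≤Δ with All.lookup components-are A∈′
  ... | v , v∈ , refl = edges (kernel A) , kernel-critical {A} (component-connected v∈) (1≤⊖⇒> 1≤Δ) , e∈A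

  module _ {C} (crit : Critical C) where

    -- Removing the part of `C` inside the component lowers the excess, so that part has positive
    -- excess; growing from its vertices to the whole component adds at least as many edges as
    -- vertices.
    critical-component : ∀ {e v} → e ∈ C → e ∈ edges (component (whole G) v) →
                         ∣ verts (component (whole G) v) ∣ < ∣ edges (component (whole G) v) ∣
    critical-component {e} {v} e∈C e∈A = lemma
      (∣ Z ∣) (∣ C ∣) (∣ vs Z ∣) (∣ vs C ∣) (∣ edges A ∣) (∣ edges A ∩ C ∣) (∣ edges A ─ C ∣)
      (∣ verts A ∣) (∣ verts A ∩ vs C ∣) (∣ verts A ─ vs C ∣)
      (crit Z (p─q⊆p C (edges A)) (λ C⊆Z → x∈p─q⇒x∉q C (edges A) (C⊆Z e∈C) e∈A))
      (∣cover∣ C (edges A ∩ C) Z λ f∈ → [ (λ f∈A → inj₁ (x∈p∩q⁺ (f∈A , f∈))) , inj₂ ]′ (∈-or-─ (edges A) f∈))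
      (∣pack∣ (edges A) (edges A ∩ C) (edges A ─ C) (p∩q⊆p (edges A) C) (p─q⊆p (edges A) C)
        (λ f∈ f∈′ → x∈p─q⇒x∉q (edges A) C f∈′ (p∩q⊆q (edges A) C f∈)))
      (∣cover∣ (verts A) (verts A ∩ vs C) (verts A ─ vs C)
        (λ u∈ → [ (λ u∈C → inj₁ (x∈p∩q⁺ (u∈ , u∈C))) , inj₂ ]′ (∈-or-─ (vs C) u∈)))
      (∣pack∣ (vs C) (verts A ∩ vs C) (vs Z) (p∩q⊆q (verts A) (vs C)) (V-mono 0 G {Z} {C} (p─q⊆p C (edges A)))
        disjoint)
      (∣verts─vs∣≤ {A} (component-connected {v} ∈⊤) C (closed A e∈A (inj₁ refl)) (∈vs⁺ {C} e∈C (inj₁ refl)))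
      where
      A = component (whole G) v
      Z = C ─ edges A
      disjoint : ∀ {u} → u ∈ verts A ∩ vs C → u ∉ vs Z
      disjoint u∈ u∈Z =
        let (f , f∈ , i) = ∈vs⁻ Z u∈Z
            (_ , r) = ∈-select⁻ (inV? (whole G) v) (p∩q⊆p (verts A) (vs C) u∈)
        in x∈p─q⇒x∉q C (edges A) f∈ (∈-select⁺ (inE? (whole G) v) (∈⊤ , reachable-source {whole G} ∈⊤ i r))
      lemma : ∀ z c vz vc a a∩ a─ va va∩ va─ → 1 + (z + vc) ≤ c + vz → c ≤ a∩ + z → a∩ + a─ ≤ a →
              va ≤ va∩ + va─ → va∩ + vz ≤ vc → va─ ≤ a─ → 1 + va ≤ a
      lemma z c vz vc a a∩ a─ va va∩ va─ p q r s t u =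
        linear _ _ (+-mono-≤ (+-mono-≤ (+-mono-≤ p q) (+-mono-≤ r s)) (+-mono-≤ t u))
          (solve 11 (λ o z c vz vc a a∩ a─ va va∩ va─ →
              (o ⊕ va) ⊕ ((((c ⊕ vz) ⊕ (a∩ ⊕ z)) ⊕ (a ⊕ (va∩ ⊕ va─))) ⊕ (vc ⊕ a─))
            ⊜ a ⊕ ((((o ⊕ (z ⊕ vc)) ⊕ c) ⊕ ((a∩ ⊕ a─) ⊕ va)) ⊕ ((va∩ ⊕ vz) ⊕ va─)))
            refl 1 z c vz vc a a∩ a─ va va∩ va─)

    -- deleting a pendant edge f of C would not lower the excess
    critical-kernel : ∀ {e v} → e ∈ C → e ∈ edges (component (whole G) v) → e ∈ edges (kernel (component (whole G) v))
    critical-kernel {e} {v} e∈C e∈A =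
      kernel-induction (λ K → ∀ f → f ∈ C → f ∈ edges A → f ∈ edges K) (λ {K} → step {K}) {A} (λ _ _ f∈ → f∈) e e∈C e∈A
      where
      A = component (whole G) v
      step : ∀ {K u} → Leaf K u → (∀ f → f ∈ C → f ∈ edges A → f ∈ edges K) →
             ∀ f → f ∈ C → f ∈ edges A → f ∈ edges (K ∖ᵥ u)
      step {K} {u} (_ , e₁ , _ , unique) stay f f∈C f∈A = ∈-select⁺ (keep? K u) (stay f f∈C f∈A , λ i →
        let u∉ : u ∉ vs (C - f)
            u∉ u∈ =
              let (g , g∈ , j) = ∈vs⁻ (C - f) u∈
                  g∈C = p─q⊆p C ⁅ f ⁆ g∈
                  (_ , r) = ∈-select⁻ (inV? (whole G) v) (closed A f∈A i)
                  g∈A = ∈-select⁺ (inE? (whole G) v) (∈⊤ , reachable-source {whole G} ∈⊤ j r)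
                  g≡f = trans (unique g (stay g g∈C g∈A) j) (sym (unique f (stay f f∈C f∈A) i))
              in x∉p-x C f (subst (_∈ C - f) g≡f g∈)
        in n≮0 {0} (lemma (∣ C ∣) (∣ C - f ∣) (∣ vs C ∣) (∣ vs (C - f) ∣)
             (∣p∣≤1+∣p-x∣ 0 G C f)
             (1+∣p∣≤∣r∣ {p = vs (C - f)} (V-mono 0 G {C - f} {C} (p─q⊆p C ⁅ f ⁆)) (∈vs⁺ {C} f∈C i) u∉)
             (crit (C - f) (p─q⊆p C ⁅ f ⁆) (λ C⊆ → x∉p-x C f (C⊆ f∈C)))))
        where
        lemma : ∀ c c′ vc vc′ → c ≤ 1 + c′ → 1 + vc′ ≤ vc → 1 + (c′ + vc) ≤ c + vc′ → 1 ≤ 0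
        lemma c c′ vc vc′ p q r = linear 1 0 (+-mono-≤ (+-mono-≤ p q) r)
          (solve 5 (λ o c c′ vc vc′ → o ⊕ (((o ⊕ c′) ⊕ vc) ⊕ (c ⊕ vc′))
                                    ⊜ (c ⊕ (o ⊕ vc′)) ⊕ (o ⊕ (c′ ⊕ vc))) refl 1 c c′ vc vc′)

    critical⇒core : ∀ {e} → e ∈ C → e ∈ edges (core G)
    critical⇒core {e} e∈C with find (components-cover-edges {e} ∈⊤)
    ... | A , A∈ , e∈A with All.lookup components-are A∈
    ... | v , _ , refl = ∈-union⁺ (Any.map⁺ (lose
            (∈-filter⁺ big? A∈ (>⇒1≤⊖ (critical-component {v = v} e∈C e∈A)))
            (critical-kernel {v = v} e∈C e∈A)))

-- Coloops and tree components

module Coloops {G : Graph n m} where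
  open Excess G
  open Trees {G = G} using (module Component)
  open Core {G = G} using (core⇒critical; critical⇒core)

  private
    module Whole = Component (whole G)

  -- The set attaining the formula for `t` in the whole graph is a maximiser.
  maximal-excess : ∃[ W ] (∀ Y → Y ≼ W)
  maximal-excess =
    let (W , _ , attained) = Whole.t-attained
    in W , λ Y → lemma (∣ Y ∣) (∣ vs Y ∣) (∣ W ∣) (∣ vs W ∣) (∣ ⊤ {n} ∣) (t (whole G) + ∣ ⊤ {m} ∣)
                   (Whole.t-bound {Y} λ _ → ∈⊤) attained
    where
    lemma : ∀ y vy w vw a b → a + y ≤ b + vy → b + vw ≤ a + w → y + vw ≤ w + vy
    lemma y vy w vw a b p q = linear _ _ (+-mono-≤ p q)
      (solve 6 (λ y vy w vw a b → (y ⊕ vw) ⊕ ((b ⊕ vy) ⊕ (a ⊕ w)) ⊜ (w ⊕ vy) ⊕ ((a ⊕ y) ⊕ (b ⊕ vw)))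
        refl y vy w vw a b)

  -- A critical set of maximal excess contains every critical set, hence e.
  critical⇒circuit-through : ∀ {k C D e} → 1 ≤ k → Minimal (Dense k G) D → Critical C → e ∈ C →
                             ∃[ C′ ] (Minimal (Dense k G) C′ × e ∈ C′)
  critical⇒circuit-through {k} {C} {D} {e} 1≤k ((_ , ∣D∣≡) , _) crit e∈C =
    let (W , max) = maximal-excess
        (C₀ , crit₀ , _ , W≼C₀) = critical-below W
        ≼C₀ : ∀ Y → Y ≼ C₀
        ≼C₀ Y = ≼-trans {Y} {W} {C₀} (max Y) W≼C₀
        C⊆C₀ : C ⊆ C₀
        C⊆C₀ = decidable-stable (C ⊆? C₀) λ C⊈C₀ →
          <⇒≱ (critical-≺-∪ crit C₀ C⊈C₀) (≼C₀ (C₀ ∪ C))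
        -- The given circuit `D` has excess k, so the maximal excess is at least k and can be
        -- lowered to k.
        (C′ , crit′ , e∈C′ , ∣C′∣≡) = critical-of-excess crit₀ (C⊆C₀ e∈C) 1≤k
          (lemma (∣ D ∣) (∣ vs D ∣) (∣ C₀ ∣) (∣ vs C₀ ∣) ∣D∣≡ (≼C₀ D))
    in C′ , critical⇒circuit 1≤k crit′ ∣C′∣≡ , e∈C′
    where
    lemma : ∀ d vd c vc → d ≡ vd + k → d + vc ≤ c + vd → vc + k ≤ c
    lemma _ vd c vc refl p = linear _ _ p
      (solve 4 (λ vd c vc k → (vc ⊕ k) ⊕ (c ⊕ vd) ⊜ c ⊕ ((vd ⊕ k) ⊕ vc)) refl vd c vc k)

  module _ (e : Fin m) where

    private
      module Deleted = Component (whole G ∖ₑ e)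
      G₀ = whole G
      G₁ = whole G ∖ₑ e

      ∣E∣≡ : ∣ ⊤ {m} ∣ ≡ suc ∣ ⊤ {m} - e ∣
      ∣E∣≡ = ≤-antisym (∣p∣≤1+∣p-x∣ 0 G ⊤ e) (x∈p⇒∣p-x∣<∣p∣ {x = e} {p = ⊤} ∈⊤)

    -- Some critical set has maximal excess, and it avoids `e`. The maximum therefore survives the
    -- deletion while the number of edges drops by one, and `t` has to make up for it.
    ¬critical⇒Y : (∀ {C} → Critical C → e ∉ C) → Y G e
    ¬critical⇒Y e∉ =
      let (W , _ , attained) = Whole.t-attained
          (C , crit , _ , W≼C) = critical-below W
          C⊆ : C ⊆ ⊤ - e
          C⊆ = λ f∈ → x∈p∧x≢y⇒x∈p-y ∈⊤ λ f≡e → e∉ crit (subst (_∈ C) f≡e f∈)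
      in lemma (t G₀) (t G₁) (∣ ⊤ {m} ∣) (∣ ⊤ {m} - e ∣) (∣ ⊤ {n} ∣) (∣ W ∣) (∣ vs W ∣) (∣ C ∣) (∣ vs C ∣)
           attained W≼C (Deleted.t-bound {C} C⊆) ∣E∣≡
      where
      lemma : ∀ t t′ a a′ v w vw c vc → t + a + vw ≤ v + w → w + vc ≤ c + vw → v + c ≤ t′ + a′ + vc →
              a ≡ 1 + a′ → 1 + t ≤ t′
      lemma t t′ _ a′ v w vw c vc p q r refl = linear _ _ (+-mono-≤ (+-mono-≤ p q) r)
        (solve 9 (λ o t t′ a′ v w vw c vc →
            (o ⊕ t) ⊕ (((v ⊕ w) ⊕ (c ⊕ vw)) ⊕ ((t′ ⊕ a′) ⊕ vc))
          ⊜ t′ ⊕ ((((t ⊕ (o ⊕ a′)) ⊕ vw) ⊕ (w ⊕ vc)) ⊕ (v ⊕ c)))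
          refl 1 t t′ a′ v w vw c vc)

    -- An optimal set for the graph without `e` misses `e`, so its union with `C` has larger excess.
    -- The maximum for the whole graph is thus larger by at least 1, which offsets the extra edge
    -- and keeps `t` from rising on deletion.
    Y⇒¬critical : Y G e → ∀ {C} → Critical C → e ∉ C
    Y⇒¬critical t< {C} crit e∈C =
      let (W , W⊆ , attained) = Deleted.t-attained
      in <⇒≱ t< (lemma (t G₀) (t G₁) (∣ ⊤ {m} ∣) (∣ ⊤ {m} - e ∣) (∣ ⊤ {n} ∣)
           (∣ W ∣) (∣ vs W ∣) (∣ W ∪ C ∣) (∣ vs (W ∪ C) ∣)
           attained (critical-≺-∪ crit W λ C⊆W → x∉p-x ⊤ e (W⊆ (C⊆W e∈C))) (Whole.t-bound {W ∪ C} λ _ → ∈⊤) ∣E∣≡)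
      where
      lemma : ∀ t t′ a a′ v w vw c vc → t′ + a′ + vw ≤ v + w → 1 + (w + vc) ≤ c + vw → v + c ≤ t + a + vc →
              a ≡ 1 + a′ → t′ ≤ t
      lemma t t′ _ a′ v w vw c vc p q r refl = linear _ _ (+-mono-≤ (+-mono-≤ p q) r)
        (solve 9 (λ o t t′ a′ v w vw c vc →
            t′ ⊕ (((v ⊕ w) ⊕ (c ⊕ vw)) ⊕ ((t ⊕ (o ⊕ a′)) ⊕ vc))
          ⊜ t ⊕ ((((t′ ⊕ a′) ⊕ vw) ⊕ (o ⊕ (w ⊕ vc))) ⊕ (v ⊕ c)))
          refl 1 t t′ a′ v w vw c vc)

    ∈∁core⇒¬critical : e ∈ ∁ (edges (core G)) → ∀ {C} → Critical C → e ∉ C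
    ∈∁core⇒¬critical e∈∁ crit e∈C = x∈∁p⇒x∉p e∈∁ (critical⇒core crit e∈C)

    ¬critical⇒∈∁core : (∀ {C} → Critical C → e ∉ C) → e ∈ ∁ (edges (core G))
    ¬critical⇒∈∁core e∉ = x∉p⇒x∈∁p λ e∈ → let (_ , crit , e∈C) = core⇒critical e∈ in e∉ crit e∈C

mainTheorem12 : ∀ {n m : ℕ} (G : Graph n m) (k : ℕ) →
    Graph.NoIsolatedVertices G →
    1 ≤ k →
    NonTrivial (M k G) →
    (Coloop (M k G) ≐ (_∈ ∁ (edges (core G)))) × ((_∈ ∁ (edges (core G))) ≐ Y G)
mainTheorem12 G k _ 1≤k ((D , circuit) , _) =
  ( (λ {e} coloop → ¬critical⇒∈∁core e λ crit e∈C →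
       let (_ , circuit′ , e∈) = critical⇒circuit-through 1≤k circuit crit e∈C in coloop circuit′ e∈)
  , (λ {e} e∈∁ circuit′ → ∈∁core⇒¬critical e e∈∁ (circuit⇒critical 1≤k circuit′)) ) ,
  ( (λ {e} e∈∁ → ¬critical⇒Y e (∈∁core⇒¬critical e e∈∁))
  , (λ {e} y → ¬critical⇒∈∁core e (Y⇒¬critical e y)) )
  where
  open Excess G
  open Coloops {G = G}
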